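{- Let $1/\mathrm{poly}(n)\le\epsilon<1/2^{k+1}$ and $k<n/2$. Any $\epsilon$-almost $k$-wise independent set in $\{0,1\}^n$ in the $L_\infty$-norm is of size $$\Omega\left(\frac{\log n}{2^k\epsilon^2\log\bigl(1/(2^{k+1}\epsilon)\bigr)}\right)=\tilde\Omega\left(\frac{\log n}{2^k\epsilon^2}\right).$$
   Context: Here $n,k$ are positive integers. A set $S'\subseteq\{0,1\}^n$ is $\epsilon$-almost $k$-wise independent in the $L_\infty$-norm if for all $1\le i_1<\cdots<i_k\le n$ and all $(\sigma_1,\ldots,\sigma_k)\in\{0,1\}^k$, $\left|\Pr_{s\sim U_{S'}}[s_{i_1}=\sigma_1\wedge\cdots\wedge s_{i_k}=\sigma_k]-2^{ -k}\right|\le\epsilon$, where $U_{S'}$ is the uniform distribution on $S'$. "$1/\mathrm{poly}(n)\le\epsilon$" means that $\epsilon$ is at least the reciprocal of some polynomial in $n$. $\tilde\Omega$ suppresses the small terms $k$, $\log\log n$ and $\log(1/\epsilon)$.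
   Formalization: The formal theorem adds the hypothesis ε² n^⌊k/2⌋ ≥ 1 (the claim fails without it, e.g. for k = 1), rounds the logarithms up to integers (the claim fails as ε approaches 1/2^(k+1)), takes ε rational, and lets the Ω constant depend on the polynomial. -}

module Defs where

open import Data.Bool using (Bool)
open import Data.Bool.Properties using () renaming (_≟_ to _≟ᵇ_)
open import Data.Fin using (Fin)
import Data.Fin as Fin
open import Data.Fin.Properties using (all?)
open import Data.Integer using (+_)
import Data.Integer as ℤ
open import Data.List using (List; length; filter; foldr)
open import Data.Nat using (ℕ; suc; NonZero)
import Data.Nat as ℕ
open import Data.Nat.Logarithm using (⌈log₂_⌉)
open import Data.Nat.Properties using (m^n≢0)
open import Data.Rational using (ℚ; _/_; _-_; _÷_; ∣_∣; _≤_; ceiling; Positive)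
open import Data.Rational.Properties using (pos⇒nonZero)
open import Data.Vec using (Vec; lookup)
open import Relation.Binary.PropositionalEquality using (_≡_)
open import Relation.Nullary using (Dec)

fromℕ : ℕ → ℚ
fromℕ m = + m / 1

2^-_ : ℕ → ℚ
2^- k = _/_ (+ 1) (2 ℕ.^ k) {{m^n≢0 2 k}}

-- Coefficients are listed from the constant term upwards.  Coefficients in ℕ
-- lose nothing: a real polynomial is bounded on ℕ by one with coefficients in ℕ.
Polynomial : Set
Polynomial = List ℕ

eval : Polynomial → ℕ → ℕ
eval p n = foldr (λ a r → a ℕ.+ n ℕ.* r) 0 p

StrictlyIncreasing : ∀ {k n} → (Fin k → Fin n) → Set
StrictlyIncreasing i = ∀ {a b} → a Fin.< b → i a Fin.< i b

Agrees : ∀ {k n} → (Fin k → Fin n) → Vec Bool k → Vec Bool n → Set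
Agrees i σ s = ∀ j → lookup s (i j) ≡ lookup σ j

agrees? : ∀ {k n} (i : Fin k → Fin n) (σ : Vec Bool k) (s : Vec Bool n) →
          Dec (Agrees i σ s)
agrees? i σ s = all? (λ j → lookup s (i j) ≟ᵇ lookup σ j)

-- The probability that a uniform element of S agrees with σ at the positions i.
-- S enumerates a set, so this is meant for S without repetitions.
Pr : ∀ {k n} (S : List (Vec Bool n)) .{{_ : NonZero (length S)}} →
     (Fin k → Fin n) → Vec Bool k → ℚ
Pr S i σ = + length (filter (agrees? i σ) S) / length S

AlmostIndependent : ∀ {n} (k : ℕ) (ε : ℚ) (S : List (Vec Bool n))
                    .{{_ : NonZero (length S)}} → Set
AlmostIndependent {n} k ε S =
  (i : Fin k → Fin n) → StrictlyIncreasing i → (σ : Vec Bool k) →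
  ∣ Pr S i σ - 2^- k ∣ ≤ ε

-- The base-2 logarithm of x ≥ 1, rounded up: ⌈log₂ x⌉ = ⌈log₂ ⌈x⌉⌉, because
-- x ≤ 2^l iff ⌈x⌉ ≤ 2^l.
-- On x > 1 it is at least 1.  For x ≥ 2 it agrees with log₂ x up to a factor 2.
⌈log₂ℚ_⌉ : ℚ → ℕ
⌈log₂ℚ x ⌉ = ⌈log₂ ℤ.∣ ceiling x ∣ ⌉

-- ⌈log₂ (1/ε)⌉
log[1/_] : (ε : ℚ) .{{_ : Positive ε}} → ℕ
log[1/ ε ] = ⌈log₂ℚ (_÷_ (fromℕ 1) ε {{pos⇒nonZero ε}}) ⌉

-- ⌈log₂ (1/(2^(k+1) ε))⌉
log[1/2^_+1*_] : (k : ℕ) (ε : ℚ) .{{_ : Positive ε}} → ℕ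
log[1/2^ k +1* ε ] = ⌈log₂ℚ (_÷_ (2^- suc k) ε {{pos⇒nonZero ε}}) ⌉

{-# OPTIONS --safe #-}
-- Fix t, the smaller of ⌊k/2⌋ and a constant depending on the polynomial.  Among the
-- s in S with s₁ = … = s_q = 0, where q = k - 2t, consider the characters that multiply
-- the signs of t coordinates, one from each of t disjoint blocks.  The product of two of
-- them depends on at most 2t further coordinates, so almost k-wise independence makes
-- the correlation of any two relatively small, at most 2^(k+1) ε.  There are so many of
-- them that N points of {1,-1}^m with pairwise correlation at most δ require m to be of
-- order log N / (δ² log (1/δ)).  This last fact is a moment computation: the Gram matrix
-- with entries raised to the power 2r exceeds, in the sense of quadratic forms, the
-- constant matrix counting the words of length 2r over m letters whose letters are paired.
module Submission where

-- Characters spread over all `k` coordinates would give only `4 ^ k` in the denominator. The prefix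
-- of `q` zeros repairs this. A product of two characters on the subcube is nonzero on only `4 ^ t`
-- of the `2 ^ k` patterns, so correlations relative to the subcube are still at most δ = 2^(k+1) ε,
-- while the subcube holds only about a 2^-q fraction of `S`. A lower bound for the subcube thus
-- gains a factor 2^q for `S`, and 4^k drops to 2^k 4^t. The remaining loss 4^t is harmless only for
-- bounded t. On the other hand the moment computation needs about δ^-2 characters, and there are
-- b^t of them with b of order n/t, because q ≤ k < n/2 leaves half of the coordinates for the
-- blocks. The bound ε ≥ 1/poly(n) makes a constant t sufficient. When `k` is too small for that
-- constant, t = ⌊k/2⌋, and the hypothesis comparing ε² with n^⌊k/2⌋ supplies the characters. The
-- combinatorics is done in ℕ and ℤ: ε is written as α/β, and every inequality is cleared of
-- denominators.

-- Positive semidefinite integer kernels and powers of Gram matrices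

module Kernels where

  open import Data.Fin using (Fin; zero; suc)
  open import Data.Integer using (ℤ; +_; -[1+_]; 0ℤ; 1ℤ; _+_; _*_; _-_; _^_; _≤_; +≤+)
  import Data.Integer.Properties as ℤP
  open import Data.Integer.Tactic.RingSolver using (solve-∀)
  open import Data.List using (List; []; _∷_; length)
  open import Data.Nat as ℕ using (ℕ; zero; suc)
  import Data.Nat.Properties as ℕP
  open import Relation.Binary.PropositionalEquality
  open import Algebra.Properties.Semiring.Sum ℤP.+-*-semiring
    using (sum; sum-cong-≗; ∑-distrib-+; *-distribˡ-sum; *-distribʳ-sum)

  sum-mono-≤ : ∀ {N} {f g : Fin N → ℤ} → (∀ i → f i ≤ g i) → sum f ≤ sum g
  sum-mono-≤ {zero}  f≤g = ℤP.≤-refl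
  sum-mono-≤ {suc N} f≤g = ℤP.+-mono-≤ (f≤g zero) (sum-mono-≤ (λ i → f≤g (suc i)))

  sum-const : ∀ N (c : ℤ) → sum {N} (λ _ → c) ≡ + N * c
  sum-const zero    c = sym (ℤP.*-zeroˡ c)
  sum-const (suc N) c = trans (cong (λ z → c + z) (sum-const N c)) (sym (ℤP.suc-* (+ N) c))

  Kernel : ℕ → Set
  Kernel N = Fin N → Fin N → ℤ

  module _ {N : ℕ} where

    total : Kernel N → ℤ
    total K = sum λ i → sum λ j → K i j

    total-cong : {K L : Kernel N} → (∀ i j → K i j ≡ L i j) → total K ≡ total L
    total-cong eq = sum-cong-≗ λ i → sum-cong-≗ λ j → eq i j

    total-+ : (K L : Kernel N) → total (λ i j → K i j + L i j) ≡ total K + total L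
    total-+ K L = trans (sum-cong-≗ λ i → ∑-distrib-+ (K i) (L i))
                        (∑-distrib-+ (λ i → sum (K i)) (λ i → sum (L i)))

    total-* : (c : ℤ) (K : Kernel N) → total (λ i j → c * K i j) ≡ c * total K
    total-* c K = sym (trans (*-distribˡ-sum c (λ i → sum (K i)))
                             (sum-cong-≗ λ i → *-distribˡ-sum c (K i)))

    total-const : (c : ℤ) → total (λ _ _ → c) ≡ + N * (+ N * c)
    total-const c = trans (sum-cong-≗ {N} λ _ → sum-const N c) (sum-const N _)

    -- Integer weights are enough: the final use sets all weights to 1, and the reductions only
    -- multiply weights by signs, which keeps them integral.
    record PSD (K : Kernel N) : Set where
      constructor psd
      field
        nonNeg : (w : Fin N → ℤ) → 0ℤ ≤ total (λ i j → w i * w j * K i j)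
    open PSD

    psd-cong : {K L : Kernel N} → (∀ i j → K i j ≡ L i j) → PSD K → PSD L
    psd-cong eq (psd p) = psd λ w →
      subst (0ℤ ≤_) (total-cong λ i j → cong (w i * w j *_) (eq i j)) (p w)

    psd-+ : {K L : Kernel N} → PSD K → PSD L → PSD (λ i j → K i j + L i j)
    psd-+ {K} {L} (psd p) (psd q) = psd λ w →
      subst (0ℤ ≤_)
        (trans (sym (total-+ _ _))
               (total-cong λ i j → sym (ℤP.*-distribˡ-+ (w i * w j) (K i j) (L i j))))
        (ℤP.+-mono-≤ (p w) (q w))

    psd-0 : PSD (λ _ _ → 0ℤ)
    psd-0 = psd λ w → ℤP.≤-reflexive (sym (trans
      (total-cong λ i j → ℤP.*-zeroʳ (w i * w j))
      (trans (total-const 0ℤ) (trans (cong (+ N *_) (ℤP.*-zeroʳ (+ N))) (ℤP.*-zeroʳ (+ N))))))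

    psd-scale : (c : ℕ) {K : Kernel N} → PSD K → PSD (λ i j → + c * K i j)
    psd-scale zero    {K} p = psd-cong (λ i j → sym (ℤP.*-zeroˡ (K i j))) psd-0
    psd-scale (suc c) {K} p = psd-cong (λ i j → sym (ℤP.suc-* (+ c) (K i j))) (psd-+ p (psd-scale c p))

    psd-rank1 : (v : Fin N → ℤ) {K : Kernel N} → PSD K → PSD (λ i j → v i * v j * K i j)
    psd-rank1 v {K} (psd p) = psd λ w →
      subst (0ℤ ≤_) (total-cong λ i j → regroup (w i) (w j) (v i) (v j) (K i j))
        (p λ i → w i * v i)
      where
      regroup : ∀ a b c d e → a * c * (b * d) * e ≡ a * b * (c * d * e)
      regroup = solve-∀

    square-nonNeg : (x : ℤ) → 0ℤ ≤ x * x
    square-nonNeg (+ n)        = subst (0ℤ ≤_) (ℤP.pos-* n n) (+≤+ ℕ.z≤n)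
    square-nonNeg (-[1+ n ]) = +≤+ ℕ.z≤n

    psd-1 : PSD (λ _ _ → 1ℤ)
    psd-1 = psd λ w → subst (0ℤ ≤_)
      (trans (*-distribʳ-sum (sum w) w)
        (sum-cong-≗ λ i → trans (*-distribˡ-sum (w i) w)
          (sum-cong-≗ λ j → sym (ℤP.*-identityʳ (w i * w j)))))
      (square-nonNeg (sum w))

    module _ {A : Set} (φ : Fin N → A → ℤ) where

      gram : List A → Kernel N
      gram []      i j = 0ℤ
      gram (s ∷ S) i j = φ i s * φ j s + gram S i j

      -- A case of the Schur product theorem with explicit factors: the Gram matrix is a sum of
      -- rank-one kernels, and each of these is absorbed into the weights.
      psd-gram* : ∀ S {K} → PSD K → PSD (λ i j → gram S i j * K i j)
      psd-gram* []      {K} p = psd-cong (λ i j → sym (ℤP.*-zeroˡ (K i j))) psd-0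
      psd-gram* (s ∷ S) {K} p = psd-cong (λ i j → sym (ℤP.*-distribʳ-+ (K i j) (φ i s * φ j s) (gram S i j)))
        (psd-+ (psd-rank1 (λ i → φ i s) p) (psd-gram* S p))

      psd-gram^ : ∀ S l → PSD (λ i j → gram S i j ^ l)
      psd-gram^ S zero    = psd-1
      psd-gram^ S (suc l) = psd-gram* S (psd-gram^ S l)

  -- The binomial coefficient l + 2 over 2.
  triangle : ℕ → ℕ
  triangle zero    = 1
  triangle (suc l) = triangle l ℕ.+ (2 ℕ.+ l)

  -- paired m r is the number of words of length 2r over m letters in which every
  -- letter occurs twice or not at all.
  paired : ℕ → ℕ → ℕ
  paired m       zero    = 1
  paired zero    (suc r) = 0
  paired (suc m) (suc r) = paired m (suc r) ℕ.+ triangle (2 ℕ.* r) ℕ.* paired m r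

  module _ {N : ℕ} {A : Set} (φ : Fin N → A → ℤ) (φ²≡1 : ∀ i s → φ i s * φ i s ≡ 1ℤ) where

    private
      G : List A → Kernel N
      G = gram φ

    -- The binomial terms of `(u + y) ^ (2 + l)` of degree at least 3 in `u`; the quadratic term is
    -- subtracted in the form that it takes when `u * u` is 1. In terms of words, these are the ones
    -- containing the letter `s` at least three times.
    power-remainder : A → List A → ℕ → Kernel N
    power-remainder s S l i j =
      let u = φ i s * φ j s; y = G S i j in
      (u + y) ^ (2 ℕ.+ l) - (y ^ (2 ℕ.+ l) + + (2 ℕ.+ l) * (u * y ^ suc l)
        + + triangle l * y ^ l)

    private
      u²≡1 : ∀ s i j → let u = φ i s * φ j s in u * u ≡ 1ℤ
      u²≡1 s i j = trans (regroup (φ i s) (φ j s)) (cong₂ _*_ (φ²≡1 i s) (φ²≡1 j s))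
        where
        regroup : ∀ a b → a * b * (a * b) ≡ a * a * (b * b)
        regroup = solve-∀

      base : ∀ u y → u * u ≡ 1ℤ →
        0ℤ ≡ (u + y) ^ 2 - (y ^ 2 + + 2 * (u * y ^ 1) + + 1 * y ^ 0)
      base u y u² = sym (trans (expand u y) (trans (cong (_- 1ℤ) u²) refl))
        where
        expand : ∀ u y → (u + y) * ((u + y) * 1ℤ)
          - (y * (y * 1ℤ) + + 2 * (u * (y * 1ℤ)) + 1ℤ * 1ℤ) ≡ u * u - 1ℤ
        expand = solve-∀

      -- Multiplying by `u + y` advances the exponent. The new linear and quadratic coefficients
      -- follow Pascal's rule, while `u` times the old quadratic term is cubic in `u`, belongs to
      -- the new remainder and is therefore added back.
      step : ∀ u y X Y L T → u * u ≡ 1ℤ →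
        (u + y) * (X - (y * (y * Y) + L * (u * (y * Y)) + T * Y))
          + T * (u * Y)
        ≡ (u + y) * X - (y * (y * (y * Y)) + (1ℤ + L) * (u * (y * (y * Y)))
          + (T + L) * (y * Y))
      step u y X Y L T u² = trans (expand u y X Y L T)
        (trans (cong (λ z → E z) u²) (collect u y X Y L T))
        where
        E : ℤ → ℤ
        E z = (u + y) * X - (y * (y * (y * Y)) + (1ℤ + L) * (u * (y * (y * Y)))
          + T * (y * Y) + z * (L * (y * Y)))
        expand : ∀ u y X Y L T →
          (u + y) * (X - (y * (y * Y) + L * (u * (y * Y)) + T * Y))
          + T * (u * Y)
          ≡ (u + y) * X - (y * (y * (y * Y)) + (1ℤ + L) * (u * (y * (y * Y)))
          + T * (y * Y) + u * u * (L * (y * Y)))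
        expand = solve-∀
        collect : ∀ u y X Y L T →
          (u + y) * X - (y * (y * (y * Y)) + (1ℤ + L) * (u * (y * (y * Y)))
          + T * (y * Y) + 1ℤ * (L * (y * Y)))
          ≡ (u + y) * X - (y * (y * (y * Y)) + (1ℤ + L) * (u * (y * (y * Y)))
          + (T + L) * (y * Y))
        collect = solve-∀

    psd-power-remainder : ∀ s S l → PSD (power-remainder s S l)
    psd-power-remainder s S zero =
      psd-cong (λ i j → base (φ i s * φ j s) (G S i j) (u²≡1 s i j)) psd-0
    psd-power-remainder s S (suc l) =
      psd-cong (λ i j → step (φ i s * φ j s) (G S i j)
                             ((φ i s * φ j s + G S i j) ^ (2 ℕ.+ l)) (G S i j ^ l) (+ (2 ℕ.+ l)) (+ triangle l)
                             (u²≡1 s i j))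
        (psd-+ (psd-gram* φ (s ∷ S) (psd-power-remainder s S l))
               (psd-scale (triangle l) (psd-rank1 (λ i → φ i s) (psd-gram^ φ S l))))

    -- Expanded over words of length `2 * r`, the power is a sum of rank-one kernels, and a paired
    -- word contributes the constant 1 because its signs square away. The induction sorts the words
    -- by how often `s` occurs: never, once, twice or at least three times. Only the first and third
    -- kinds contain paired words; the others are kept as positive semidefinite surplus.
    psd-gram-moment : ∀ S r → PSD (λ i j → G S i j ^ (2 ℕ.* r) - + paired (length S) r)
    psd-gram-moment []      zero    = psd-0
    psd-gram-moment (s ∷ S) zero    = psd-0
    psd-gram-moment []      (suc r) =
      psd-cong (λ i j → refl) psd-0
    psd-gram-moment (s ∷ S) (suc r) =
      subst (λ l → PSD (λ i j → G (s ∷ S) i j ^ l - + paired (suc (length S)) (suc r))) double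
        (psd-cong collect
          (psd-+ (psd-power-remainder s S (2 ℕ.* r))
            (psd-+ (subst (λ l → PSD (λ i j → G S i j ^ l - + p (suc r))) (sym double)
                          (psd-gram-moment S (suc r)))
              (psd-+ (psd-scale (2 ℕ.+ 2 ℕ.* r) (psd-rank1 (λ i → φ i s) (psd-gram^ φ S (suc (2 ℕ.* r)))))
                     (psd-scale T (psd-gram-moment S r))))))
      where
      p = paired (length S)
      T = triangle (2 ℕ.* r)

      double : 2 ℕ.+ 2 ℕ.* r ≡ 2 ℕ.* suc r
      double = sym (ℕP.*-suc 2 r)

      ring : ∀ P Q a T Y f g →
        P - (Q + a + T * Y) + (Q - f + (a + T * (Y - g))) ≡ P - (f + T * g)
      ring = solve-∀

      collect : ∀ i j →
        power-remainder s S (2 ℕ.* r) i j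
          + (G S i j ^ (2 ℕ.+ 2 ℕ.* r) - + p (suc r)
            + (+ (2 ℕ.+ 2 ℕ.* r) * (φ i s * φ j s * G S i j ^ suc (2 ℕ.* r))
              + + T * (G S i j ^ (2 ℕ.* r) - + p r)))
        ≡ G (s ∷ S) i j ^ (2 ℕ.+ 2 ℕ.* r) - + paired (suc (length S)) (suc r)
      collect i j =
        trans (ring (G (s ∷ S) i j ^ (2 ℕ.+ 2 ℕ.* r)) (G S i j ^ (2 ℕ.+ 2 ℕ.* r))
                    (+ (2 ℕ.+ 2 ℕ.* r) * (φ i s * φ j s * G S i j ^ suc (2 ℕ.* r)))
                    (+ T) (G S i j ^ (2 ℕ.* r)) (+ p (suc r)) (+ p r))
              (cong (λ z → G (s ∷ S) i j ^ (2 ℕ.+ 2 ℕ.* r) - z)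
                    (trans (cong (λ z → + p (suc r) + z) (sym (ℤP.pos-* T (p r))))
                           (sym (ℤP.pos-+ (p (suc r)) (T ℕ.* p r)))))

    paired≤moment : ∀ S r →
      + N * (+ N * + paired (length S) r) ≤ total (λ i j → G S i j ^ (2 ℕ.* r))
    paired≤moment S r = subst₂ _≤_ (trans (ℤP.+-identityˡ (total F)) (total-const {N} f)) collect
      (ℤP.+-monoˡ-≤ (total F) (PSD.nonNeg (psd-gram-moment S r) (λ _ → 1ℤ)))
      where
      f = + paired (length S) r
      F : Kernel N
      F _ _ = f
      cancel : ∀ x f → 1ℤ * 1ℤ * (x - f) + f ≡ x
      cancel = solve-∀
      collect : total (λ i j → 1ℤ * 1ℤ * (G S i j ^ (2 ℕ.* r) - f)) + total F
                ≡ total (λ i j → G S i j ^ (2 ℕ.* r))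
      collect = trans (sym (total-+ (λ i j → 1ℤ * 1ℤ * (G S i j ^ (2 ℕ.* r) - f)) F))
                      (total-cong λ i j → cancel (G S i j ^ (2 ℕ.* r)) f)

-- Lower bound on the number of paired words

module PairedWords where

  open import Data.Nat
  open import Data.Nat.Properties
  open import Data.Nat.Tactic.RingSolver using (solve-∀)
  open import Relation.Binary.PropositionalEquality
  open Kernels using (triangle; paired)

  triangle-even : ∀ r → triangle (2 * r) ≡ suc r * suc (2 * r)
  triangle-even zero    = refl
  triangle-even (suc r) = begin
    triangle (2 * suc r)                                     ≡⟨ cong triangle (*-suc 2 r) ⟩
    triangle (2 * r) + (2 + 2 * r) + (2 + suc (2 * r))       ≡⟨ cong (λ z → z + (2 + 2 * r) + (2 + suc (2 * r))) (triangle-even r) ⟩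
    suc r * suc (2 * r) + (2 + 2 * r) + (2 + suc (2 * r))    ≡⟨ ring r ⟩
    suc (suc r) * suc (2 * suc r)                            ∎
    where
    open ≡-Reasoning
    ring : ∀ r → suc r * suc (2 * r) + (2 + 2 * r) + (2 + suc (2 * r)) ≡ suc (suc r) * suc (2 * suc r)
    ring = solve-∀

  -- The first letter of a word counted by paired is free, and so is the position of
  -- its partner.
  paired-absorb : ∀ m r → paired (suc m) (suc r) ≡ suc m * (suc (2 * r) * paired m r)
  paired-absorb zero    zero    = refl
  paired-absorb zero    (suc r)
    rewrite *-zeroʳ (triangle (2 * suc r)) | *-zeroʳ (suc (2 * suc r)) = refl
  paired-absorb (suc m) r = begin
    paired (suc m) (suc r) + triangle (2 * r) * paired (suc m) r
      ≡⟨ cong₂ (λ x y → x + y * paired (suc m) r) (paired-absorb m r) (triangle-even r) ⟩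
    suc m * (suc (2 * r) * paired m r) + suc r * suc (2 * r) * paired (suc m) r
      ≡⟨ split (suc m) r (paired m r) (paired (suc m) r) ⟩
    suc (2 * r) * (suc m * paired m r + r * paired (suc m) r + paired (suc m) r)
      ≡⟨ cong (λ x → suc (2 * r) * (x + paired (suc m) r)) (shift r) ⟩
    suc (2 * r) * (suc m * paired (suc m) r + paired (suc m) r)
      ≡⟨ join (suc m) r (paired (suc m) r) ⟩
    suc (suc m) * (suc (2 * r) * paired (suc m) r) ∎
    where
    open ≡-Reasoning
    split : ∀ m r x y → m * (suc (2 * r) * x) + suc r * suc (2 * r) * y ≡ suc (2 * r) * (m * x + r * y + y)
    split = solve-∀
    join : ∀ m r y → suc (2 * r) * (m * y + y) ≡ suc m * (suc (2 * r) * y)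
    join = solve-∀
    regroup : ∀ m r x y P → m * x + suc r * P + m * (suc r * suc (2 * r) * y)
                          ≡ m * x + suc r * P + suc r * (m * (suc (2 * r) * y))
    regroup = solve-∀
    -- Double counting of pairs of a word and a letter absent from it: a word with `r` paired
    -- letters misses `suc m - r` letters. The sum form avoids the subtraction.
    shift : ∀ r → suc m * paired m r + r * paired (suc m) r ≡ suc m * paired (suc m) r
    shift zero    = +-identityʳ _
    shift (suc r) = begin
      suc m * paired m (suc r) + suc r * paired (suc m) (suc r)
        ≡⟨ cong (λ z → suc m * paired m (suc r) + suc r * z) (paired-absorb m r) ⟩
      suc m * paired m (suc r) + suc r * (suc m * (suc (2 * r) * paired m r))
        ≡⟨ ring (suc m) r (paired m (suc r)) (paired m r) ⟩
      suc m * (paired m (suc r) + suc r * suc (2 * r) * paired m r)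
        ≡⟨ cong (λ z → suc m * (paired m (suc r) + z * paired m r)) (triangle-even r) ⟨
      suc m * paired (suc m) (suc r) ∎
      where
      ring : ∀ m r x y → m * x + suc r * (m * (suc (2 * r) * y)) ≡ m * (x + suc r * suc (2 * r) * y)
      ring = solve-∀

  !*^≤ : ∀ r j → r ! * r ^ j ≤ (j + r) !
  !*^≤ r zero    = ≤-reflexive (*-identityʳ (r !))
  !*^≤ r (suc j) = begin
    r ! * (r * r ^ j)   ≡⟨ ring (r !) r (r ^ j) ⟩
    r * (r ! * r ^ j)   ≤⟨ *-mono-≤ (≤-trans (m≤n+m r j) (n≤1+n _)) (!*^≤ r j) ⟩
    suc (j + r) * (j + r) ! ∎
    where
    open ≤-Reasoning
    ring : ∀ a b c → a * (b * c) ≡ b * (a * c)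
    ring = solve-∀

  -- By `paired-absorb`, `paired m r` is the falling factorial m (m-1) ... (m-r+1) times the product
  -- (2r)!/(2^r r!) of the first r odd numbers. Every falling factor is at least `m ∸ r`.
  ∸^*!≤paired : ∀ m r → (m ∸ r) ^ r * (r + r) ! ≤ paired m r * (2 ^ r * r !)
  ∸^*!≤paired m       zero    = ≤-refl
  ∸^*!≤paired zero    (suc r) = z≤n
  ∸^*!≤paired (suc m) (suc r) = begin
    (m ∸ r) * (m ∸ r) ^ r * (suc r + suc r) !
      ≡⟨ cong (λ z → (m ∸ r) * (m ∸ r) ^ r * (suc z !)) (+-suc r r) ⟩
    (m ∸ r) * (m ∸ r) ^ r * (suc (suc (r + r)) * (suc (r + r) * (r + r) !))
      ≡⟨ front (m ∸ r) ((m ∸ r) ^ r) r ((r + r) !) ⟩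
    (m ∸ r) * (suc (suc (r + r)) * suc (r + r)) * ((m ∸ r) ^ r * (r + r) !)
      ≤⟨ *-mono-≤ (*-monoˡ-≤ (suc (suc (r + r)) * suc (r + r)) (≤-trans (m∸n≤m m r) (n≤1+n m))) (∸^*!≤paired m r) ⟩
    suc m * (suc (suc (r + r)) * suc (r + r)) * (paired m r * (2 ^ r * r !))
      ≡⟨ back (suc m) r (paired m r) (2 ^ r) (r !) ⟩
    suc m * (suc (2 * r) * paired m r) * (2 * 2 ^ r * (suc r * r !))
      ≡⟨ cong (_* (2 * 2 ^ r * (suc r * r !))) (paired-absorb m r) ⟨
    paired (suc m) (suc r) * (2 ^ suc r * suc r !) ∎
    where
    open ≤-Reasoning
    front : ∀ a b r f → a * b * (suc (suc (r + r)) * (suc (r + r) * f)) ≡ a * (suc (suc (r + r)) * suc (r + r)) * (b * f)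
    front = solve-∀
    back : ∀ m r p t f → m * (suc (suc (r + r)) * suc (r + r)) * (p * (t * f)) ≡ m * (suc (2 * r) * p) * (2 * t * (suc r * f))
    back = solve-∀

  ^-distrib-* : ∀ a b r → (a * b) ^ r ≡ a ^ r * b ^ r
  ^-distrib-* a b zero    = refl
  ^-distrib-* a b (suc r) rewrite ^-distrib-* a b r = ring a b (a ^ r) (b ^ r)
    where
    ring : ∀ a b x y → a * b * (x * y) ≡ a * x * (b * y)
    ring = solve-∀

  -- One factor `2 ^ r` pays for m - r ≥ m/2, the other is the denominator of (2r)!/(2^r r!), whose
  -- remaining quotient (2r)!/r! is at least r^r.
  paired-lower-bound : ∀ m r → 2 * r ≤ m → (m * r) ^ r ≤ paired m r * 4 ^ r
  paired-lower-bound m r 2r≤m = begin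
    (m * r) ^ r                    ≤⟨ ^-monoˡ-≤ r (*-monoˡ-≤ r m≤2[m∸r]) ⟩
    (2 * (m ∸ r) * r) ^ r          ≡⟨ trans (^-distrib-* (2 * (m ∸ r)) r r) (cong (_* r ^ r) (^-distrib-* 2 (m ∸ r) r)) ⟩
    2 ^ r * (m ∸ r) ^ r * r ^ r    ≡⟨ *-assoc (2 ^ r) _ _ ⟩
    2 ^ r * ((m ∸ r) ^ r * r ^ r)  ≤⟨ *-monoʳ-≤ (2 ^ r) half ⟩
    2 ^ r * (paired m r * 2 ^ r)   ≡⟨ ring (2 ^ r) (paired m r) ⟩
    paired m r * (2 ^ r * 2 ^ r)   ≡⟨ cong (paired m r *_) (^-distrib-* 2 2 r) ⟨
    paired m r * 4 ^ r             ∎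
    where
    open ≤-Reasoning
    ring : ∀ a b → a * (b * a) ≡ b * (a * a)
    ring = solve-∀
    r≤m : r ≤ m
    r≤m = ≤-trans (m≤m+n r _) 2r≤m
    m≤2[m∸r] : m ≤ 2 * (m ∸ r)
    m≤2[m∸r] = begin
      m                     ≡⟨ m∸n+n≡m r≤m ⟨
      (m ∸ r) + r           ≤⟨ +-monoʳ-≤ (m ∸ r) (m+n≤o⇒m≤o∸n r (subst (_≤ m) (cong (r +_) (+-identityʳ r)) 2r≤m)) ⟩
      (m ∸ r) + (m ∸ r)     ≡⟨ cong (λ z → (m ∸ r) + z) (+-identityʳ (m ∸ r)) ⟨
      2 * (m ∸ r)           ∎
    instance _ = r !≢0
    half : (m ∸ r) ^ r * r ^ r ≤ paired m r * 2 ^ r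
    half = *-cancelʳ-≤ _ _ (r !) (begin
      (m ∸ r) ^ r * r ^ r * r !     ≡⟨ swap ((m ∸ r) ^ r) (r ^ r) (r !) ⟩
      (m ∸ r) ^ r * (r ! * r ^ r)   ≤⟨ *-monoʳ-≤ ((m ∸ r) ^ r) (!*^≤ r r) ⟩
      (m ∸ r) ^ r * (r + r) !       ≤⟨ ∸^*!≤paired m r ⟩
      paired m r * (2 ^ r * r !)    ≡⟨ *-assoc (paired m r) (2 ^ r) (r !) ⟨
      paired m r * 2 ^ r * r !      ∎)
      where
      swap : ∀ a b c → a * b * c ≡ a * (c * b)
      swap = solve-∀

-- Almost orthogonal sign vectors by the moment method

module AlmostOrthogonal where

  open import Data.Fin using (Fin; zero; suc)
  open import Data.Fin.Properties using (punchInᵢ≢i)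
  open import Data.Integer using (ℤ; +_; -[1+_]; 1ℤ; ∣_∣; +≤+)
  import Data.Integer as ℤ
  import Data.Integer.Properties as ℤP
  open import Data.List using (List; []; _∷_; length)
  open import Data.Nat
  open import Data.Nat.Properties
  open import Data.Nat.Tactic.RingSolver using (solve-∀)
  open import Data.Product using (Σ-syntax; _×_; _,_)
  open import Data.Vec.Functional using (removeAt)
  open import Relation.Binary.PropositionalEquality
  open import Relation.Nullary using (¬_; Dec; yes; no; contradiction)
  open Kernels
  open PairedWords
  open import Algebra.Properties.Semiring.Sum ℤP.+-*-semiring using (sum; sum-remove)

  ^-cancelˡ-≤ : ∀ r {x y} .{{_ : NonZero r}} → x ^ r ≤ y ^ r → x ≤ y
  ^-cancelˡ-≤ r xʳ≤yʳ = ≮⇒≥ λ y<x → <⇒≱ (^-monoˡ-< r y<x) xʳ≤yʳ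

  ^-cancelʳ-≤ : ∀ b {x y} → 1 < b → b ^ x ≤ b ^ y → x ≤ y
  ^-cancelʳ-≤ b 1<b bˣ≤bʸ = ≮⇒≥ λ y<x → <⇒≱ (^-monoʳ-< b 1<b y<x) bˣ≤bʸ

  n<2^n : ∀ n → n < 2 ^ n
  n<2^n zero    = s≤s z≤n
  n<2^n (suc n) = begin-strict
    suc n          <⟨ +-mono-≤ (m^n>0 2 n) (n<2^n n) ⟩
    2 ^ n + 2 ^ n  ≡⟨ cong (λ z → 2 ^ n + z) (+-identityʳ (2 ^ n)) ⟨
    2 ^ suc n      ∎
    where open ≤-Reasoning

  last-true : {P : ℕ → Set} → (∀ n → Dec (P n)) → ∀ d {a} → P a → ¬ P (d + a) →
              Σ[ r ∈ ℕ ] a ≤ r × P r × ¬ P (suc r)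
  last-true P? zero    Pa ¬Pa = contradiction Pa ¬Pa
  last-true {P} P? (suc d) {a} Pa ¬Pd with P? (suc a)
  ... | no ¬P  = a , ≤-refl , Pa , ¬P
  ... | yes Ps with last-true P? d {suc a} Ps (λ p → ¬Pd (subst P (+-suc d a) p))
  ...   | r , a<r , Pr , ¬Pr = r , ≤-trans (n≤1+n a) a<r , Pr , ¬Pr

  even-power : ∀ x r → x ℤ.^ (2 * r) ≡ + ((∣ x ∣ * ∣ x ∣) ^ r)
  even-power x zero    = refl
  even-power x (suc r) = begin
    x ℤ.^ (2 * suc r)                    ≡⟨ cong (x ℤ.^_) (*-suc 2 r) ⟩
    x ℤ.* (x ℤ.* x ℤ.^ (2 * r))          ≡⟨ ℤP.*-assoc x x (x ℤ.^ (2 * r)) ⟨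
    x ℤ.* x ℤ.* x ℤ.^ (2 * r)            ≡⟨ cong₂ ℤ._*_ (square x) (even-power x r) ⟩
    + (∣ x ∣ * ∣ x ∣) ℤ.* + ((∣ x ∣ * ∣ x ∣) ^ r)  ≡⟨ ℤP.pos-* (∣ x ∣ * ∣ x ∣) _ ⟨
    + ((∣ x ∣ * ∣ x ∣) ^ suc r)          ∎
    where
    open ≡-Reasoning
    square : ∀ x → x ℤ.* x ≡ + (∣ x ∣ * ∣ x ∣)
    square (+ n)    = sym (ℤP.pos-* n n)
    square -[1+ n ] = refl

  sum-with-peak : ∀ {N} (f : Fin N → ℤ) i {c d : ℕ} → f i ℤ.≤ + c → (∀ j → i ≢ j → f j ℤ.≤ + d) →
                  sum f ℤ.≤ + (c + N * d)
  sum-with-peak {suc N} f i {c} {d} peak rest = begin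
    sum f                         ≡⟨ sum-remove {i = i} f ⟩
    f i ℤ.+ sum (removeAt f i)    ≤⟨ ℤP.+-mono-≤ peak (sum-mono-≤ λ j → rest _ (≢-sym (punchInᵢ≢i i j))) ⟩
    + c ℤ.+ sum {N} (λ _ → + d)   ≡⟨ cong (λ z → + c ℤ.+ z) (trans (sum-const N (+ d)) (sym (ℤP.pos-* N d))) ⟩
    + c ℤ.+ + (N * d)             ≡⟨ ℤP.pos-+ c (N * d) ⟨
    + (c + N * d)                 ≤⟨ +≤+ (+-monoʳ-≤ c (*-monoˡ-≤ d (n≤1+n N))) ⟩
    + (c + suc N * d)             ∎
    where open ℤP.≤-Reasoning

  module _ {N : ℕ} .{{_ : NonZero N}} {A : Set} (φ : Fin N → A → ℤ)
           (φ²≡1 : ∀ i s → φ i s ℤ.* φ i s ≡ 1ℤ) (S : List A) where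

    private
      m = length S

    gram-diagonal : ∀ i → gram φ S i i ≡ + m
    gram-diagonal i = go S
      where
      go : ∀ S → gram φ S i i ≡ + length S
      go []      = refl
      go (s ∷ S) = cong₂ ℤ._+_ (φ²≡1 i s) (go S)

    module _ (α β : ℕ) (small : ∀ i j → i ≢ j → ∣ gram φ S i j ∣ * β ≤ α * m) where

      -- The total of the powers of all Gram entries is bounded below by the paired words, and above
      -- by `N` diagonal entries of size `m` and at most `N * N` small ones. One factor `N` cancels.
      moment-bound : ∀ r →
        N * paired m r * (β * β) ^ r ≤ (m * m) ^ r * ((β * β) ^ r + N * (α * α) ^ r)
      moment-bound r = *-cancelˡ-≤ N (ℤP.drop‿+≤+ (begin
        + (N * (N * paired m r * (β * β) ^ r))
          ≡⟨ cong +_ (ring₁ N (paired m r) ((β * β) ^ r)) ⟩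
        + ((β * β) ^ r * (N * (N * paired m r)))
          ≡⟨ trans (ℤP.pos-* ((β * β) ^ r) _) (cong (λ z → + ((β * β) ^ r) ℤ.* z)
               (trans (ℤP.pos-* N _) (cong (λ z → + N ℤ.* z) (ℤP.pos-* N _)))) ⟩
        + ((β * β) ^ r) ℤ.* (+ N ℤ.* (+ N ℤ.* + paired m r))
          ≤⟨ ℤP.*-monoˡ-≤-nonNeg (+ ((β * β) ^ r)) (paired≤moment φ φ²≡1 S r) ⟩
        + ((β * β) ^ r) ℤ.* total (λ i j → gram φ S i j ℤ.^ (2 * r))
          ≡⟨ trans (sym (total-* (+ ((β * β) ^ r)) (λ i j → gram φ S i j ℤ.^ (2 * r)))) (total-cong entry) ⟩
        total K
          ≤⟨ sum-mono-≤ (λ i → sum-with-peak (K i) i (peak i) (rest i)) ⟩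
        sum {N} (λ _ → + (m² * β² + N * (m² * α²)))
          ≡⟨ trans (sum-const N _) (sym (ℤP.pos-* N _)) ⟩
        + (N * (m² * β² + N * (m² * α²)))
          ≡⟨ cong +_ (ring₂ N m² β² α²) ⟩
        + (N * (m² * (β² + N * α²))) ∎))
        where
        open ℤP.≤-Reasoning
        m² = (m * m) ^ r
        α² = (α * α) ^ r
        β² = (β * β) ^ r
        K : Kernel N
        K i j = + ((∣ gram φ S i j ∣ * β * (∣ gram φ S i j ∣ * β)) ^ r)
        ring₁ : ∀ n p b → n * (n * p * b) ≡ b * (n * (n * p))
        ring₁ = solve-∀
        ring₂ : ∀ n m b a → n * (m * b + n * (m * a)) ≡ n * (m * (b + n * a))
        ring₂ = solve-∀
        interchange : ∀ x y → x * y * (x * y) ≡ x * x * (y * y)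
        interchange = solve-∀
        square-* : ∀ x y → (x * y * (x * y)) ^ r ≡ (x * x) ^ r * (y * y) ^ r
        square-* x y = trans (cong (_^ r) (interchange x y)) (^-distrib-* (x * x) (y * y) r)
        entry : ∀ i j → + ((β * β) ^ r) ℤ.* gram φ S i j ℤ.^ (2 * r) ≡ K i j
        entry i j = trans (cong (λ z → + ((β * β) ^ r) ℤ.* z) (even-power (gram φ S i j) r))
          (trans (sym (ℤP.pos-* ((β * β) ^ r) _))
                 (cong +_ (trans (*-comm ((β * β) ^ r) _) (sym (square-* ∣ gram φ S i j ∣ β)))))
        peak : ∀ i → K i i ℤ.≤ + (m² * β²)
        peak i = ℤP.≤-reflexive (cong +_ (trans
          (cong (λ z → (∣ z ∣ * β * (∣ z ∣ * β)) ^ r) (gram-diagonal i)) (square-* m β)))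
        rest : ∀ i j → i ≢ j → K i j ℤ.≤ + (m² * α²)
        rest i j i≢j = +≤+ (≤-trans
          (^-monoˡ-≤ r (*-mono-≤ (small i j i≢j) (small i j i≢j)))
          (≤-reflexive (trans (square-* α m) (*-comm α² m²))))

      -- The exponent 2r is chosen as large as possible with (β/α)^2r ≤ N, where the
      -- diagonal and the off-diagonal part of the moment balance.
      approximately-orthogonal-bound :
        ∀ L .{{_ : NonZero α}} → 2 * α ≤ β → β * β ≤ N * (α * α) → β ≤ α * 2 ^ L → N ≤ 2 ^ m →
        Σ[ r ∈ ℕ ] N < 2 ^ (4 * r * L) × r * (β * β) ≤ 8 * (α * α) * m
      approximately-orthogonal-bound L 2α≤β β²≤Nα² β≤α2^L N≤2^m
        with last-true P? N {1} P₁ ¬Pₙ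
        where
        open ≤-Reasoning
        P : ℕ → Set
        P r = (β * β) ^ r ≤ N * (α * α) ^ r
        P? : ∀ r → Dec (P r)
        P? r = (β * β) ^ r ≤? N * (α * α) ^ r
        P₁ : P 1
        P₁ = subst₂ (λ x y → x ≤ N * y) (sym (*-identityʳ (β * β))) (sym (*-identityʳ (α * α))) β²≤Nα²
        -- A crude end for the search: (β/α)^2 is at least 4, and 4^(N+1) exceeds N.
        ¬Pₙ : ¬ P (N + 1)
        ¬Pₙ p = <⇒≱ (begin-strict
          N            <⟨ n<2^n N ⟩
          2 ^ N        ≤⟨ ^-monoʳ-≤ 2 (m≤m+n N 1) ⟩
          2 ^ (N + 1)  ≤⟨ ^-monoˡ-≤ (N + 1) (s≤s (s≤s (z≤n {2}))) ⟩
          4 ^ (N + 1)  ∎) (four^≤ p)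
          where
          instance
            _ = m*n≢0 α α
            _ = m^n≢0 (α * α) (N + 1)
          four^≤ : P (N + 1) → 4 ^ (N + 1) ≤ N
          four^≤ p = *-cancelʳ-≤ _ _ ((α * α) ^ (N + 1)) (begin
            4 ^ (N + 1) * (α * α) ^ (N + 1)  ≡⟨ ^-distrib-* 4 (α * α) (N + 1) ⟨
            (4 * (α * α)) ^ (N + 1)          ≤⟨ ^-monoˡ-≤ (N + 1) (≤-trans (≤-reflexive (ring α)) (*-mono-≤ 2α≤β 2α≤β)) ⟩
            (β * β) ^ (N + 1)                ≤⟨ p ⟩
            N * (α * α) ^ (N + 1)            ∎)
            where
            ring : ∀ a → 4 * (a * a) ≡ 2 * a * (2 * a)
            ring = solve-∀
      ... | r , 1≤r , Pr , ¬Psr = r , upper , lower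
        where
        open ≤-Reasoning
        instance
          r≢0 : NonZero r
          r≢0 = >-nonZero 1≤r
          α²≢0 : NonZero (α * α)
          α²≢0 = m*n≢0 α α

        α²ʳ = (α * α) ^ r
        β²ʳ = (β * β) ^ r

        -- 4^r ≤ (β/α)^(2r) ≤ N ≤ 2^m. This puts `r` in the range of `paired-lower-bound`.
        2r≤m : 2 * r ≤ m
        2r≤m = ^-cancelʳ-≤ 2 (s≤s (s≤s z≤n)) (≤-trans (*-cancelʳ-≤ _ _ α²ʳ {{m^n≢0 (α * α) r}} (begin
          2 ^ (2 * r) * α²ʳ      ≡⟨ cong (_* α²ʳ) (^-*-assoc 2 2 r) ⟨
          4 ^ r * α²ʳ            ≡⟨ ^-distrib-* 4 (α * α) r ⟨
          (4 * (α * α)) ^ r      ≤⟨ ^-monoˡ-≤ r (≤-trans (≤-reflexive (ring α)) (*-mono-≤ 2α≤β 2α≤β)) ⟩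
          β²ʳ                    ≤⟨ Pr ⟩
          N * α²ʳ                ∎)) N≤2^m)
          where
          ring : ∀ a → 4 * (a * a) ≡ 2 * a * (2 * a)
          ring = solve-∀

        -- Maximality of `r` gives N < (β/α)^(2(r+1)) ≤ 2^(2L(r+1)), and r + 1 ≤ 2r.
        upper : N < 2 ^ (4 * r * L)
        upper = begin-strict
          N                     <⟨ *-cancelʳ-< ((α * α) ^ suc r) N (2 ^ (L * 2 * suc r)) (begin-strict
              N * (α * α) ^ suc r                       <⟨ ≰⇒> ¬Psr ⟩
              (β * β) ^ suc r                           ≤⟨ ^-monoˡ-≤ (suc r) (*-mono-≤ β≤α2^L β≤α2^L) ⟩
              (α * 2 ^ L * (α * 2 ^ L)) ^ suc r         ≡⟨ cong (_^ suc r) (ring α (2 ^ L)) ⟩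
              ((2 ^ L) ^ 2 * (α * α)) ^ suc r           ≡⟨ ^-distrib-* ((2 ^ L) ^ 2) (α * α) (suc r) ⟩
              ((2 ^ L) ^ 2) ^ suc r * (α * α) ^ suc r     ≡⟨ cong (_* (α * α) ^ suc r) (trans (cong (_^ suc r) (^-*-assoc 2 L 2)) (^-*-assoc 2 (L * 2) (suc r))) ⟩
              2 ^ (L * 2 * suc r) * (α * α) ^ suc r     ∎) ⟩
          2 ^ (L * 2 * suc r)   ≤⟨ ^-monoʳ-≤ 2 (begin
              L * 2 * suc r          ≤⟨ *-monoʳ-≤ (L * 2) (+-monoˡ-≤ r 1≤r) ⟩
              L * 2 * (r + r)        ≡⟨ ring′ L r ⟩
              4 * r * L              ∎) ⟩
          2 ^ (4 * r * L)       ∎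
          where
          ring : ∀ a p → a * p * (a * p) ≡ p * (p * 1) * (a * a)
          ring = solve-∀
          ring′ : ∀ l r → l * 2 * (r + r) ≡ 4 * r * l
          ring′ = solve-∀

        instance
          m≢0 : NonZero m
          m≢0 = >-nonZero (≤-trans (≤-trans 1≤r (m≤m+n r _)) 2r≤m)

        balanced : paired m r * β²ʳ ≤ 2 * ((m * m) ^ r * α²ʳ)
        balanced = *-cancelˡ-≤ N (begin
          N * (paired m r * β²ʳ)                 ≡⟨ *-assoc N _ _ ⟨
          N * paired m r * β²ʳ                   ≤⟨ moment-bound r ⟩
          (m * m) ^ r * (β²ʳ + N * α²ʳ)          ≤⟨ *-monoʳ-≤ ((m * m) ^ r) (+-monoˡ-≤ (N * α²ʳ) Pr) ⟩
          (m * m) ^ r * (N * α²ʳ + N * α²ʳ)      ≡⟨ ring ((m * m) ^ r) N α²ʳ ⟩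
          N * (2 * ((m * m) ^ r * α²ʳ))          ∎)
          where
          ring : ∀ m n a → m * (n * a + n * a) ≡ n * (2 * (m * a))
          ring = solve-∀

        -- The 8 is the 4 of `paired-lower-bound` times the 2 of `balanced`, which is weakened to
        -- `2 ^ r` so that an r-th root can be taken.
        power : (m * r * (β * β)) ^ r ≤ (m * (8 * (α * α) * m)) ^ r
        power = begin
          (m * r * (β * β)) ^ r              ≡⟨ ^-distrib-* (m * r) (β * β) r ⟩
          (m * r) ^ r * β²ʳ                  ≤⟨ *-monoˡ-≤ β²ʳ (paired-lower-bound m r 2r≤m) ⟩
          paired m r * 4 ^ r * β²ʳ           ≡⟨ swap (paired m r) (4 ^ r) β²ʳ ⟩
          4 ^ r * (paired m r * β²ʳ)         ≤⟨ *-monoʳ-≤ (4 ^ r) balanced ⟩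
          4 ^ r * (2 * ((m * m) ^ r * α²ʳ))  ≤⟨ *-monoʳ-≤ (4 ^ r) (*-monoˡ-≤ _ (subst (_≤ 2 ^ r) (*-identityʳ 2) (^-monoʳ-≤ 2 1≤r))) ⟩
          4 ^ r * (2 ^ r * ((m * m) ^ r * α²ʳ))  ≡⟨ cong (λ z → 4 ^ r * (2 ^ r * z)) (^-distrib-* (m * m) (α * α) r) ⟨
          4 ^ r * (2 ^ r * (m * m * (α * α)) ^ r)  ≡⟨ cong (4 ^ r *_) (^-distrib-* 2 (m * m * (α * α)) r) ⟨
          4 ^ r * (2 * (m * m * (α * α))) ^ r  ≡⟨ ^-distrib-* 4 (2 * (m * m * (α * α))) r ⟨
          (4 * (2 * (m * m * (α * α)))) ^ r  ≡⟨ cong (_^ r) (ring m (α * α)) ⟩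
          (m * (8 * (α * α) * m)) ^ r        ∎
          where
          swap : ∀ p f b → p * f * b ≡ f * (p * b)
          swap = solve-∀
          ring : ∀ m a → 4 * (2 * (m * m * a)) ≡ m * (8 * a * m)
          ring = solve-∀

        lower : r * (β * β) ≤ 8 * (α * α) * m
        lower = *-cancelˡ-≤ m (subst (_≤ m * (8 * (α * α) * m)) (*-assoc m r (β * β)) (^-cancelˡ-≤ r power))

-- Block characters and sums over patterns

module Characters where

  open import Defs using (StrictlyIncreasing; agrees?)
  open import Data.Bool using (Bool; true; false; _xor_; _∧_; not; if_then_else_)
  open import Data.Fin using (Fin; zero; suc; _↑ˡ_; _↑ʳ_; toℕ)
  import Data.Fin as Fin
  open import Data.Fin.Properties using (toℕ-↑ˡ; toℕ-↑ʳ; toℕ<n; <-cmp)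
  open import Data.Integer using (ℤ; +_; 0ℤ; 1ℤ; -1ℤ; ∣_∣; _+_; _*_)
  import Data.Integer.Properties as ℤP
  open import Data.Integer.Tactic.RingSolver using (solve-∀)
  open import Data.List using (List; []; _∷_; length; filter; filterᵇ; lookup)
  open import Data.Nat as ℕ using (ℕ; zero; suc; _≤_; _<_; z≤n; s≤s)
  import Data.Nat.Properties as ℕP
  open import Data.List.Properties using (filter-accept; filter-reject)
  import Data.Nat.Tactic.RingSolver as ℕR
  open import Data.Product using (Σ-syntax; _,_)
  open import Data.Vec as Vec using (Vec; []; _∷_; tabulate)
  open import Data.Vec.Properties using (lookup∘tabulate; tabulate∘lookup; tabulate-cong)
  open import Function using (_∘_)
  open import Relation.Binary using (tri<; tri≈; tri>)
  open import Relation.Binary.PropositionalEquality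
  open import Relation.Nullary using (yes; no; contradiction)
  open Kernels

  sgn : Bool → ℤ
  sgn false = 1ℤ
  sgn true  = -1ℤ

  sgn² : ∀ x → sgn x * sgn x ≡ 1ℤ
  sgn² false = refl
  sgn² true  = refl

  sgn-xor : ∀ x y → sgn (x xor y) ≡ sgn x * sgn y
  sgn-xor false false = refl
  sgn-xor false true  = refl
  sgn-xor true  false = refl
  sgn-xor true  true  = refl

  module _ {A : Set} where

    ΣL : (A → ℤ) → List A → ℤ
    ΣL h []      = 0ℤ
    ΣL h (s ∷ S) = h s + ΣL h S

    ΣL-cong : ∀ {g h} → (∀ s → g s ≡ h s) → ∀ S → ΣL g S ≡ ΣL h S
    ΣL-cong eq []      = refl
    ΣL-cong eq (s ∷ S) = cong₂ _+_ (eq s) (ΣL-cong eq S)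

    ΣL-gram : ∀ {N} (φ : Fin N → A → ℤ) (z : A → Bool) i j S →
              ΣL (λ s → if z s then φ i s * φ j s else 0ℤ) S ≡ gram φ (filterᵇ z S) i j
    ΣL-gram φ z i j []      = refl
    ΣL-gram φ z i j (s ∷ S) with z s
    ... | true  = cong (λ x → φ i s * φ j s + x) (ΣL-gram φ z i j S)
    ... | false = trans (ℤP.+-identityˡ _) (ΣL-gram φ z i j S)

  ΣV : ∀ {k} → (Vec Bool k → ℤ) → ℤ
  ΣV {zero}  g = g []
  ΣV {suc k} g = ΣV (λ τ → g (false ∷ τ)) + ΣV (λ τ → g (true ∷ τ))

  ΣV-cong : ∀ {k} {g h : Vec Bool k → ℤ} → (∀ τ → g τ ≡ h τ) → ΣV g ≡ ΣV h
  ΣV-cong {zero}  eq = eq []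
  ΣV-cong {suc k} eq = cong₂ _+_ (ΣV-cong λ τ → eq (false ∷ τ)) (ΣV-cong λ τ → eq (true ∷ τ))

  ΣV-0 : ∀ k → ΣV {k} (λ _ → 0ℤ) ≡ 0ℤ
  ΣV-0 zero    = refl
  ΣV-0 (suc k) = cong₂ _+_ (ΣV-0 k) (ΣV-0 k)

  ΣV-+ : ∀ {k} (g h : Vec Bool k → ℤ) → ΣV (λ τ → g τ + h τ) ≡ ΣV g + ΣV h
  ΣV-+ {zero}  g h = refl
  ΣV-+ {suc k} g h = trans
    (cong₂ _+_ (ΣV-+ (g ∘ (false ∷_)) (h ∘ (false ∷_))) (ΣV-+ (g ∘ (true ∷_)) (h ∘ (true ∷_))))
    (interchange (ΣV (g ∘ (false ∷_))) (ΣV (h ∘ (false ∷_))) (ΣV (g ∘ (true ∷_))) (ΣV (h ∘ (true ∷_))))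
    where
    interchange : ∀ a b c d → a + b + (c + d) ≡ a + c + (b + d)
    interchange = solve-∀

  ΣV-* : ∀ {k} c (g : Vec Bool k → ℤ) → ΣV (λ τ → c * g τ) ≡ c * ΣV g
  ΣV-* {zero}  c g = refl
  ΣV-* {suc k} c g = trans
    (cong₂ _+_ (ΣV-* c (g ∘ (false ∷_))) (ΣV-* c (g ∘ (true ∷_))))
    (sym (ℤP.*-distribˡ-+ c (ΣV (g ∘ (false ∷_))) (ΣV (g ∘ (true ∷_)))))

  module _ {k n} (i : Fin k → Fin n) where

    restrict : Vec Bool n → Vec Bool k
    restrict s = tabulate (Vec.lookup s ∘ i)

    count : List (Vec Bool n) → Vec Bool k → ℕ
    count S τ = length (filter (agrees? i τ) S)

  -- The vector `s` agrees with exactly one pattern, its own restriction, so the sum collapses.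
  ΣV-indicator : ∀ {k n} (i : Fin k → Fin n) (g : Vec Bool k → ℤ) s →
                 ΣV (λ τ → g τ * + count i (s ∷ []) τ) ≡ g (restrict i s)
  ΣV-indicator {k} i g s = trans (ΣV-cong λ τ → cong (g τ *_) (indicator τ)) (δ (restrict i s) g)
    where
    equal? : ∀ {k} → Vec Bool k → Vec Bool k → Bool
    equal? []      []      = true
    equal? (x ∷ σ) (y ∷ τ) = not (x xor y) ∧ equal? σ τ

    δ : ∀ {k} σ (g : Vec Bool k → ℤ) → ΣV (λ τ → g τ * (if equal? σ τ then 1ℤ else 0ℤ)) ≡ g σ
    δ []          g = ℤP.*-identityʳ (g [])
    δ {suc k} (false ∷ σ) g = trans
      (cong₂ _+_ (δ σ (g ∘ (false ∷_))) (trans (ΣV-cong λ τ → ℤP.*-zeroʳ (g (true ∷ τ))) (ΣV-0 k)))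
      (ℤP.+-identityʳ (g (false ∷ σ)))
    δ {suc k} (true ∷ σ)  g = trans
      (cong₂ _+_ (trans (ΣV-cong λ τ → ℤP.*-zeroʳ (g (false ∷ τ))) (ΣV-0 k)) (δ σ (g ∘ (true ∷_))))
      (ℤP.+-identityˡ (g (true ∷ σ)))

    equal?-refl : ∀ {k} (σ : Vec Bool k) → equal? σ σ ≡ true
    equal?-refl []          = refl
    equal?-refl (false ∷ σ) = equal?-refl σ
    equal?-refl (true ∷ σ)  = equal?-refl σ

    equal?-sound : ∀ {k} (σ τ : Vec Bool k) → equal? σ τ ≡ true → σ ≡ τ
    equal?-sound []          []          e = refl
    equal?-sound (false ∷ σ) (false ∷ τ) e = cong (false ∷_) (equal?-sound σ τ e)
    equal?-sound (true ∷ σ)  (true ∷ τ)  e = cong (true ∷_) (equal?-sound σ τ e)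

    indicator : ∀ τ → + count i (s ∷ []) τ ≡ (if equal? (restrict i s) τ then 1ℤ else 0ℤ)
    indicator τ with agrees? i τ s
    ... | yes a = trans (cong (λ S → + length S) (filter-accept (agrees? i τ) {xs = []} a))
        (cong (λ b → if b then 1ℤ else 0ℤ) (sym (trans (cong (λ σ → equal? σ τ) σ≡τ) (equal?-refl τ))))
      where
      σ≡τ : restrict i s ≡ τ
      σ≡τ = trans (tabulate-cong a) (tabulate∘lookup τ)
    ... | no ¬a with equal? (restrict i s) τ in e
    ...   | false = cong (λ S → + length S) (filter-reject (agrees? i τ) {xs = []} ¬a)
    ...   | true  = contradiction
      (λ j → trans (sym (lookup∘tabulate (Vec.lookup s ∘ i) j))
                   (cong (λ v → Vec.lookup v j) (equal?-sound (restrict i s) τ e))) ¬a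

  count-∷ : ∀ {k n} (i : Fin k → Fin n) s S τ → count i (s ∷ S) τ ≡ count i (s ∷ []) τ ℕ.+ count i S τ
  count-∷ i s S τ with agrees? i τ s
  ... | yes a = trans (cong length (filter-accept (agrees? i τ) a))
                      (cong (λ z → length z ℕ.+ count i S τ) (sym (filter-accept (agrees? i τ) {xs = []} a)))
  ... | no ¬a = trans (cong length (filter-reject (agrees? i τ) ¬a))
                      (cong (λ z → length z ℕ.+ count i S τ) (sym (filter-reject (agrees? i τ) {xs = []} ¬a)))

  -- Regrouping by pattern expresses the sum through the counts, which are what almost independence
  -- controls.
  ΣL-restrict : ∀ {k n} (i : Fin k → Fin n) (g : Vec Bool k → ℤ) S →
                ΣL (g ∘ restrict i) S ≡ ΣV (λ τ → g τ * + count i S τ)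
  ΣL-restrict {k} i g []  = sym (trans (ΣV-cong λ τ → ℤP.*-zeroʳ (g τ)) (ΣV-0 k))
  ΣL-restrict i g (s ∷ S) = sym (trans
    (ΣV-cong λ τ → trans (cong (λ c → g τ * + c) (count-∷ i s S τ))
      (trans (cong (g τ *_) (ℤP.pos-+ (count i (s ∷ []) τ) (count i S τ))) (ℤP.*-distribˡ-+ (g τ) (+ count i (s ∷ []) τ) (+ count i S τ))))
    (trans (ΣV-+ (λ τ → g τ * + count i (s ∷ []) τ) (λ τ → g τ * + count i S τ)) (cong₂ _+_ (ΣV-indicator i g s) (sym (ΣL-restrict i g S)))))

  module Blocks (b′ rest : ℕ) where

    b : ℕ
    b = 2 ℕ.+ b′

    size : ℕ → ℕ
    size zero    = rest
    size (suc t) = b ℕ.+ size t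

    -- A block contributes two coordinates to the product of two characters.  If both
    -- characters use the same one, its sign cancels, and lo and hi are only fillers
    -- that keep the number of tested coordinates equal to k.
    record Gate : Set where
      field
        lo hi : Fin b
        lo<hi : lo Fin.< hi
        same  : Bool

      value : Bool → Bool → ℤ
      value x y = if same then 1ℤ else sgn x * sgn y

    open Gate

    record Separates (p p′ : Fin b) (g : Gate) : Set where
      field
        value-correct : ∀ (f : Fin b → Bool) → sgn (f p) * sgn (f p′) ≡ value g (f (lo g)) (f (hi g))
        distinct      : p ≢ p′ → same g ≡ false
        equal         : p ≡ p′ → same g ≡ true

    gate : (p p′ : Fin b) → Σ[ g ∈ Gate ] Separates p p′ g
    gate p p′ with <-cmp p p′
    ... | tri< p<p′ p≢p′ _ = record { lo = p ; hi = p′ ; lo<hi = p<p′ ; same = false } ,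
      record { value-correct = λ f → refl ; distinct = λ _ → refl ; equal = λ e → contradiction e p≢p′ }
    ... | tri≈ _ refl _ = record { lo = zero ; hi = suc zero ; lo<hi = s≤s z≤n ; same = true } ,
      record { value-correct = λ f → sgn² (f p) ; distinct = λ ne → contradiction refl ne ; equal = λ _ → refl }
    ... | tri> _ p≢p′ p′<p = record { lo = p′ ; hi = p ; lo<hi = p′<p ; same = false } ,
      record { value-correct = λ f → ℤP.*-comm (sgn (f p)) (sgn (f p′)) ; distinct = λ _ → refl ; equal = λ e → contradiction e p≢p′ }

    character : ∀ t → (Fin t → Fin b) → (Fin (size t) → Bool) → Bool
    character zero    T f = false
    character (suc t) T f = f (T zero ↑ˡ size t) xor character t (T ∘ suc) (f ∘ (b ↑ʳ_))

    vanishes : ∀ q {r} → (Fin (q ℕ.+ r) → Bool) → Bool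
    vanishes zero    f = true
    vanishes (suc q) f = not (f zero) ∧ vanishes q (f ∘ suc)

    embed : ∀ q t → (Fin t → Gate) → Fin (q ℕ.+ t ℕ.* 2) → Fin (q ℕ.+ size t)
    embed (suc q) t       G zero          = zero
    embed (suc q) t       G (suc j)       = suc (embed q t G j)
    embed zero    (suc t) G zero          = lo (G zero) ↑ˡ size t
    embed zero    (suc t) G (suc zero)    = hi (G zero) ↑ˡ size t
    embed zero    (suc t) G (suc (suc j)) = b ↑ʳ embed zero t (G ∘ suc) j

    ↑ˡ<↑ʳ : ∀ {r} (x : Fin b) (y : Fin r) → (x ↑ˡ r) Fin.< (b ↑ʳ y)
    ↑ˡ<↑ʳ {r} x y rewrite toℕ-↑ˡ x r | toℕ-↑ʳ b y = ℕP.≤-trans (toℕ<n x) (ℕP.m≤m+n b (toℕ y))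

    embed-increasing : ∀ q t G → StrictlyIncreasing (embed q t G)
    embed-increasing (suc q) t G {zero}  {suc y} _         = s≤s z≤n
    embed-increasing (suc q) t G {suc x} {suc y} (s≤s x<y) = s≤s (embed-increasing q t G x<y)
    embed-increasing zero (suc t) G {zero} {suc zero} _ =
      subst₂ _<_ (sym (toℕ-↑ˡ (lo (G zero)) _)) (sym (toℕ-↑ˡ (hi (G zero)) _)) (lo<hi (G zero))
    embed-increasing zero (suc t) G {zero}     {suc (suc y)} _ = ↑ˡ<↑ʳ (lo (G zero)) _
    embed-increasing zero (suc t) G {suc zero} {suc (suc y)} _ = ↑ˡ<↑ʳ (hi (G zero)) _
    embed-increasing zero (suc t) G {suc zero} {suc zero} (s≤s ())
    embed-increasing zero (suc t) G {suc (suc x)} {suc zero} (s≤s ())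
    embed-increasing zero (suc t) G {suc (suc x)} {suc (suc y)} (s≤s (s≤s x<y)) =
      subst₂ _<_ (sym (toℕ-↑ʳ b (embed zero t (G ∘ suc) x))) (sym (toℕ-↑ʳ b (embed zero t (G ∘ suc) y)))
        (ℕP.+-monoʳ-< b (embed-increasing zero t (G ∘ suc) x<y))

    gated : ∀ {k} → Gate → (Vec Bool k → ℤ) → Vec Bool (2 ℕ.+ k) → ℤ
    gated G h (x ∷ y ∷ τ) = value G x y * h τ

    -- As a function of the tested coordinates alone, this is the indicator of the subcube times the
    -- product of two characters; `test-embed` makes the identification.
    test : ∀ q t → (Fin t → Gate) → Vec Bool (q ℕ.+ t ℕ.* 2) → ℤ
    test (suc q) t       G (false ∷ τ) = test q t G τ
    test (suc q) t       G (true ∷ τ)  = 0ℤ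
    test zero    zero    G []          = 1ℤ
    test zero    (suc t) G τ           = gated (G zero) (test zero t (G ∘ suc)) τ

    test-embed : ∀ q t {T T′} (G : Fin t → Gate) → (∀ a → Separates (T a) (T′ a) (G a)) →
                 (f : Fin (q ℕ.+ size t) → Bool) →
                 test q t G (tabulate (f ∘ embed q t G))
                 ≡ (if vanishes q f then sgn (character t T (f ∘ (q ↑ʳ_))) * sgn (character t T′ (f ∘ (q ↑ʳ_)))
                                    else 0ℤ)
    test-embed (suc q) t G sep f with f zero
    ... | false = test-embed q t G sep (f ∘ suc)
    ... | true  = refl
    test-embed zero zero    G sep f = refl
    test-embed zero (suc t) {T} {T′} G sep f = begin
      value (G zero) (f (lo (G zero) ↑ˡ size t)) (f (hi (G zero) ↑ˡ size t)) * test zero t (G ∘ suc) _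
        ≡⟨ cong₂ _*_ (sym (Separates.value-correct (sep zero) (λ x → f (x ↑ˡ size t))))
                     (test-embed zero t (G ∘ suc) (sep ∘ suc) (f ∘ (b ↑ʳ_))) ⟩
      sgn x * sgn y * (sgn c * sgn d)     ≡⟨ interchange (sgn x) (sgn y) (sgn c) (sgn d) ⟩
      sgn x * sgn c * (sgn y * sgn d)     ≡⟨ cong₂ _*_ (sgn-xor x c) (sgn-xor y d) ⟨
      sgn (x xor c) * sgn (y xor d)       ∎
      where
      open ≡-Reasoning
      x = f (T zero ↑ˡ size t)
      y = f (T′ zero ↑ˡ size t)
      c = character t (T ∘ suc) (f ∘ (b ↑ʳ_))
      d = character t (T′ ∘ suc) (f ∘ (b ↑ʳ_))
      interchange : ∀ a b c d → a * b * (c * d) ≡ a * c * (b * d)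
      interchange = solve-∀

    module _ (G : Gate) {k} (h : Vec Bool k → ℤ) where

      ΣV-gated : ΣV (gated G h) ≡ value G false false * ΣV h + value G false true * ΣV h
                                  + (value G true false * ΣV h + value G true true * ΣV h)
      ΣV-gated = cong₂ _+_ (cong₂ _+_ (ΣV-* (value G false false) h) (ΣV-* (value G false true) h))
                           (cong₂ _+_ (ΣV-* (value G true false) h) (ΣV-* (value G true true) h))

      ΣV-same : same G ≡ true → ΣV (gated G h) ≡ + 4 * ΣV h
      ΣV-same eq = trans ΣV-gated (trans
        (cong (λ s → let v = λ x y → if s then 1ℤ else sgn x * sgn y in
                 v false false * ΣV h + v false true * ΣV h + (v true false * ΣV h + v true true * ΣV h)) eq)
        (ring (ΣV h)))
        where
        ring : ∀ z → 1ℤ * z + 1ℤ * z + (1ℤ * z + 1ℤ * z) ≡ + 4 * z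
        ring = solve-∀

      ΣV-distinct : same G ≡ false → ΣV (gated G h) ≡ 0ℤ
      ΣV-distinct eq = trans ΣV-gated (trans
        (cong (λ s → let v = λ x y → if s then 1ℤ else sgn x * sgn y in
                 v false false * ΣV h + v false true * ΣV h + (v true false * ΣV h + v true true * ΣV h)) eq)
        (ring (ΣV h)))
        where
        ring : ∀ z → 1ℤ * z + -1ℤ * z + (-1ℤ * z + 1ℤ * z) ≡ 0ℤ
        ring = solve-∀

      ΣV-zero : ΣV h ≡ 0ℤ → ΣV (gated G h) ≡ 0ℤ
      ΣV-zero eq = trans ΣV-gated (trans
        (cong (λ z → value G false false * z + value G false true * z + (value G true false * z + value G true true * z)) eq)
        (ring (value G false false) (value G false true) (value G true false) (value G true true)))
        where
        ring : ∀ a b c d → a * 0ℤ + b * 0ℤ + (c * 0ℤ + d * 0ℤ) ≡ 0ℤ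
        ring = solve-∀

    ΣV-test-pad : ∀ q t G → ΣV (test (suc q) t G) ≡ ΣV (test q t G)
    ΣV-test-pad q t G = trans (cong (λ z → ΣV (test q t G) + z) (ΣV-0 (q ℕ.+ t ℕ.* 2))) (ℤP.+-identityʳ (ΣV (test q t G)))

    ΣV-test-same : ∀ q t G → (∀ a → same (G a) ≡ true) → ΣV (test q t G) ≡ + (4 ℕ.^ t)
    ΣV-test-same (suc q) t       G all = trans (ΣV-test-pad q t G) (ΣV-test-same q t G all)
    ΣV-test-same zero    zero    G all = refl
    ΣV-test-same zero    (suc t) G all = trans
      (ΣV-same (G zero) (test zero t (G ∘ suc)) (all zero))
      (trans (cong (+ 4 *_) (ΣV-test-same zero t (G ∘ suc) (all ∘ suc))) (sym (ℤP.pos-* 4 (4 ℕ.^ t))))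

    -- Orthogonality of characters: the product of two distinct signs has mean zero over its two
    -- bits, and a single such factor annihilates the whole sum.
    ΣV-test-distinct : ∀ q t G a → same (G a) ≡ false → ΣV (test q t G) ≡ 0ℤ
    ΣV-test-distinct (suc q) t       G a       eq = trans (ΣV-test-pad q t G) (ΣV-test-distinct q t G a eq)
    ΣV-test-distinct zero    (suc t) G zero    eq = ΣV-distinct (G zero) (test zero t (G ∘ suc)) eq
    ΣV-test-distinct zero    (suc t) G (suc a) eq =
      ΣV-zero (G zero) (test zero t (G ∘ suc)) (ΣV-test-distinct zero t (G ∘ suc) a eq)

    ∣value∣ : ∀ G x y → ∣ value G x y ∣ ≡ 1
    ∣value∣ G x y with same G
    ... | true = refl
    ∣value∣ G false false | false = refl
    ∣value∣ G false true  | false = refl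
    ∣value∣ G true  false | false = refl
    ∣value∣ G true  true  | false = refl

    -- The test is a sign on the `4 ^ t` patterns with zero prefix and 0 elsewhere. Having `4 ^ t`
    -- here in place of `2 ^ k` is the purpose of the prefix.
    ∣ΣV-test∣≤ : ∀ q t G (c : Vec Bool (q ℕ.+ t ℕ.* 2) → ℤ) {D} → (∀ τ → ∣ c τ ∣ ≤ D) →
                 ∣ ΣV (λ τ → test q t G τ * c τ) ∣ ≤ 4 ℕ.^ t ℕ.* D
    ∣ΣV-test∣≤ (suc q) t G c {D} c≤D =
      subst (λ z → ∣ z ∣ ≤ 4 ℕ.^ t ℕ.* D)
        (sym (trans (cong (λ z → ΣV (λ τ → test q t G τ * c (false ∷ τ)) + z) (ΣV-0 (q ℕ.+ t ℕ.* 2)))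
                    (ℤP.+-identityʳ (ΣV (λ τ → test q t G τ * c (false ∷ τ))))))
        (∣ΣV-test∣≤ q t G (c ∘ (false ∷_)) (λ τ → c≤D (false ∷ τ)))
    ∣ΣV-test∣≤ zero zero G c {D} c≤D = subst₂ _≤_ (cong ∣_∣ (sym (ℤP.*-identityˡ (c [])))) (sym (ℕP.+-identityʳ D)) (c≤D [])
    ∣ΣV-test∣≤ zero (suc t) G c {D} c≤D = begin
      ∣ part false false + part false true + (part true false + part true true) ∣
        ≤⟨ ℕP.≤-trans (ℤP.∣i+j∣≤∣i∣+∣j∣ (part false false + part false true) _)
             (ℕP.+-mono-≤ (ℤP.∣i+j∣≤∣i∣+∣j∣ (part false false) _) (ℤP.∣i+j∣≤∣i∣+∣j∣ (part true false) _)) ⟩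
      ∣ part false false ∣ ℕ.+ ∣ part false true ∣ ℕ.+ (∣ part true false ∣ ℕ.+ ∣ part true true ∣)
        ≤⟨ ℕP.+-mono-≤ (ℕP.+-mono-≤ (bound false false) (bound false true)) (ℕP.+-mono-≤ (bound true false) (bound true true)) ⟩
      X ℕ.+ X ℕ.+ (X ℕ.+ X)
        ≡⟨ ring (4 ℕ.^ t) D ⟩
      4 ℕ.^ suc t ℕ.* D ∎
      where
      open ℕP.≤-Reasoning
      X = 4 ℕ.^ t ℕ.* D
      G′ = G ∘ suc
      ring : ∀ f d → f ℕ.* d ℕ.+ f ℕ.* d ℕ.+ (f ℕ.* d ℕ.+ f ℕ.* d) ≡ 4 ℕ.* f ℕ.* d
      ring = ℕR.solve-∀
      part : Bool → Bool → ℤ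
      part x y = ΣV (λ τ → value (G zero) x y * test zero t G′ τ * c (x ∷ y ∷ τ))
      bound : ∀ x y → ∣ part x y ∣ ≤ X
      bound x y = subst (_≤ X)
        (sym (trans (cong ∣_∣ (trans (ΣV-cong λ τ → ℤP.*-assoc (value (G zero) x y) (test zero t G′ τ) (c (x ∷ y ∷ τ)))
                                     (ΣV-* (value (G zero) x y) (λ τ → test zero t G′ τ * c (x ∷ y ∷ τ)))))
             (trans (ℤP.∣i*j∣≡∣i∣*∣j∣ (value (G zero) x y) _)
             (trans (cong (ℕ._* ∣ ΣV (λ τ → test zero t G′ τ * c (x ∷ y ∷ τ)) ∣) (∣value∣ (G zero) x y)) (ℕP.*-identityˡ _)))))
        (∣ΣV-test∣≤ zero t G′ (λ τ → c (x ∷ y ∷ τ)) (λ τ → c≤D (x ∷ y ∷ τ)))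

-- Correlations of the characters on a subcube

module Subcubes where

  open import Defs using (StrictlyIncreasing)
  open import Data.Bool using (Bool; true; false; if_then_else_)
  open import Data.Fin using (Fin; zero; suc; _↑ʳ_; finToFun; funToFin)
  import Data.Fin as Fin
  open import Data.Fin.Properties using (funToFin-finToFin; finToFun-funToFin; injective⇒≤; ¬∀⟶∃¬; 2↔Bool)
  open import Data.Integer using (ℤ; +_; 0ℤ; ∣_∣; -_; _+_; _*_; _-_)
  import Data.Integer.Properties as ℤP
  open import Data.Integer.Tactic.RingSolver using (solve-∀)
  open import Data.List using (List; []; _∷_; length; filterᵇ; lookup)
  open import Data.Nat as ℕ using (ℕ; zero; suc; _≤_; NonZero)
  import Data.Nat.Properties as ℕP
  import Data.Nat.Tactic.RingSolver as ℕR
  open import Data.Product using (_,_; proj₁; proj₂)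
  open import Data.Vec as Vec using (Vec)
  open import Data.Sum using (inj₁; inj₂)
  open import Function using (_∘_; Inverse)
  open import Relation.Binary.PropositionalEquality
  open Kernels
  open Characters
  open AlmostOrthogonal

  m≤n+∣+m-+n∣ : ∀ m n → m ≤ n ℕ.+ ∣ + m - + n ∣
  m≤n+∣+m-+n∣ m n with ℕP.≤-total m n
  ... | inj₁ m≤n = ℕP.≤-trans m≤n (ℕP.m≤m+n n _)
  ... | inj₂ n≤m = subst (λ d → m ≤ n ℕ.+ d) (sym distance) (ℕP.m≤n+m∸n m n)
    where
    distance : ∣ + m - + n ∣ ≡ m ℕ.∸ n
    distance = trans (ℤP.∣i-j∣≡∣j-i∣ (+ m) (+ n)) (trans (cong ∣_∣ (ℤP.m-n≡m⊖n n m)) (ℤP.∣⊖∣-≤ n≤m))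

  m≤n+∣+n-+m∣ : ∀ m n → m ≤ n ℕ.+ ∣ + n - + m ∣
  m≤n+∣+n-+m∣ m n = subst (λ d → m ≤ n ℕ.+ d) (ℤP.∣i-j∣≡∣j-i∣ (+ m) (+ n)) (m≤n+∣+m-+n∣ m n)

  module _ {N : ℕ} {A : Set} (χ : Fin N → A → Bool) where

    private
      φ : Fin N → A → ℤ
      φ i s = sgn (χ i s)

    gram-agree : ∀ S i j → (∀ a → χ i (lookup S a) ≡ χ j (lookup S a)) → gram φ S i j ≡ + length S
    gram-agree []      i j eq = refl
    gram-agree (s ∷ S) i j eq = cong₂ _+_
      (trans (cong (λ x → sgn x * φ j s) (eq zero)) (sgn² (χ j s))) (gram-agree S i j (eq ∘ suc))

    -- An index is determined by its signs on `S`, read as a number below `2 ^ length S`.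
    distinct⇒≤2^ : ∀ S → (∀ i j → gram φ S i j ≡ + length S → i ≡ j) → N ≤ 2 ℕ.^ length S
    distinct⇒≤2^ S separated = injective⇒≤ {f = code} λ {i} {j} eq →
      separated i j (gram-agree S i j λ a → bits-injective (trans (sym (finToFun-funToFin (bits i) a))
        (trans (cong (λ c → finToFun c a) eq) (finToFun-funToFin (bits j) a))))
      where
      bits : Fin N → Fin (length S) → Fin 2
      bits i a = Inverse.from 2↔Bool (χ i (lookup S a))
      code : Fin N → Fin (2 ℕ.^ length S)
      code i = funToFin (bits i)
      bits-injective : ∀ {x y} → Inverse.from 2↔Bool x ≡ Inverse.from 2↔Bool y → x ≡ y
      bits-injective {false} {false} e = refl
      bits-injective {true}  {true}  e = refl

  finToFun-injective : ∀ {m n} (i j : Fin (m ℕ.^ n)) → (∀ a → finToFun {m} {n} i a ≡ finToFun j a) → i ≡ j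
  finToFun-injective {m} {n} i j eq = trans (sym (funToFin-finToFin {n} {m} i))
    (trans (funToFin-cong eq) (funToFin-finToFin {n} {m} j))
    where
    funToFin-cong : ∀ {m n} {f g : Fin n → Fin m} → (∀ a → f a ≡ g a) → funToFin f ≡ funToFin g
    funToFin-cong {n = zero}  eq = refl
    funToFin-cong {n = suc n} eq = cong₂ Fin.combine (eq zero) (funToFin-cong (eq ∘ suc))

  module Subcube (b′ rest q t : ℕ) where

    open Blocks b′ rest public

    k n N : ℕ
    k = q ℕ.+ t ℕ.* 2
    n = q ℕ.+ size t
    N = b ℕ.^ t

    χ : Fin N → Vec Bool n → Bool
    χ i s = character t (finToFun i) (Vec.lookup s ∘ (q ↑ʳ_))

    φ : Fin N → Vec Bool n → ℤ
    φ i s = sgn (χ i s)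

    subcube : List (Vec Bool n) → List (Vec Bool n)
    subcube = filterᵇ (λ s → vanishes q (Vec.lookup s))

    gates : Fin N → Fin N → Fin t → Gate
    gates i j a = proj₁ (gate (finToFun i a) (finToFun j a))

    module _ (S : List (Vec Bool n)) (α β : ℕ)
             (almost : ∀ (i : Fin k → Fin n) → StrictlyIncreasing i → ∀ σ →
                ∣ + (2 ℕ.^ k) * + count i S σ - + length S ∣ ℕ.* β ≤ 2 ℕ.^ k ℕ.* α ℕ.* length S) where

      private
        M = length S
        P = 2 ℕ.^ k
        Q = 4 ℕ.^ t
        S₀ = subcube S
        m = length S₀
        D = Q ℕ.* (P ℕ.* α ℕ.* M)

      gram≡ΣV : ∀ i j → gram φ S₀ i j ≡ ΣV (λ τ → test q t (gates i j) τ * + count (embed q t (gates i j)) S τ)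
      gram≡ΣV i j = begin
        gram φ S₀ i j
          ≡⟨ ΣL-gram φ (λ s → vanishes q (Vec.lookup s)) i j S ⟨
        ΣL (λ s → if vanishes q (Vec.lookup s) then φ i s * φ j s else 0ℤ) S
          ≡⟨ ΣL-cong (λ s → test-embed q t (gates i j) (λ a → proj₂ (gate (finToFun i a) (finToFun j a))) (Vec.lookup s)) S ⟨
        ΣL (λ s → test q t (gates i j) (restrict (embed q t (gates i j)) s)) S
          ≡⟨ ΣL-restrict (embed q t (gates i j)) (test q t (gates i j)) S ⟩
        ΣV (λ τ → test q t (gates i j) τ * + count (embed q t (gates i j)) S τ) ∎
        where open ≡-Reasoning

      -- Under exact independence each count would be M/P, and the Gram entry M/P times the sum of
      -- the test. The deviation comes only from the patterns on which the test is nonzero.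
      discrepancy : ∀ i j →
        ∣ + P * gram φ S₀ i j - + M * ΣV (test q t (gates i j)) ∣ ℕ.* β ≤ D
      discrepancy i j = subst (_≤ D) (trans (cong ∣_∣ collect) (ℤP.∣i*j∣≡∣i∣*∣j∣ (+ P * gram φ S₀ i j - + M * ΣV (test q t (gates i j))) (+ β)))
        (∣ΣV-test∣≤ q t G c λ τ → subst (_≤ P ℕ.* α ℕ.* M)
           (sym (ℤP.∣i*j∣≡∣i∣*∣j∣ (+ P * + count e S τ - + M) (+ β)))
           (almost e (embed-increasing q t G) τ))
        where
        open ≡-Reasoning
        G = gates i j
        e = embed q t G
        g = test q t G
        c : Vec Bool k → ℤ
        c τ = (+ P * + count e S τ - + M) * + β
        split : ∀ g p c m b → g * ((p * c - m) * b) ≡ p * b * (g * c) + (- (m * b)) * g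
        split = solve-∀
        join : ∀ p b x m w → p * b * x + (- (m * b)) * w ≡ (p * x - m * w) * b
        join = solve-∀
        collect : ΣV (λ τ → g τ * c τ) ≡ (+ P * gram φ S₀ i j - + M * ΣV g) * + β
        collect = begin
          ΣV (λ τ → g τ * c τ)
            ≡⟨ ΣV-cong (λ τ → split (g τ) (+ P) (+ count e S τ) (+ M) (+ β)) ⟩
          ΣV (λ τ → + P * + β * (g τ * + count e S τ) + (- (+ M * + β)) * g τ)
            ≡⟨ ΣV-+ (λ τ → + P * + β * (g τ * + count e S τ)) (λ τ → (- (+ M * + β)) * g τ) ⟩
          ΣV (λ τ → + P * + β * (g τ * + count e S τ)) + ΣV (λ τ → (- (+ M * + β)) * g τ)
            ≡⟨ cong₂ _+_ (ΣV-* (+ P * + β) (λ τ → g τ * + count e S τ)) (ΣV-* (- (+ M * + β)) g) ⟩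
          + P * + β * ΣV (λ τ → g τ * + count e S τ) + (- (+ M * + β)) * ΣV g
            ≡⟨ cong (λ z → + P * + β * z + (- (+ M * + β)) * ΣV g) (gram≡ΣV i j) ⟨
          + P * + β * gram φ S₀ i j + (- (+ M * + β)) * ΣV g
            ≡⟨ join (+ P) (+ β) (gram φ S₀ i j) (+ M) (ΣV g) ⟩
          (+ P * gram φ S₀ i j - + M * ΣV g) * + β ∎

      -- Distinct indices choose different coordinates in some block, so the ideal value is zero and
      -- only the deviation is left.
      off-diagonal : ∀ i j → i ≢ j → ∣ gram φ S₀ i j ∣ ℕ.* β ≤ Q ℕ.* (α ℕ.* M)
      off-diagonal i j i≢j = ℕP.*-cancelˡ-≤ P {{ℕP.m^n≢0 2 k}} (begin
        P ℕ.* (∣ gram φ S₀ i j ∣ ℕ.* β)  ≡⟨ ℕP.*-assoc P _ β ⟨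
        P ℕ.* ∣ gram φ S₀ i j ∣ ℕ.* β    ≡⟨ cong (ℕ._* β) (ℤP.∣i*j∣≡∣i∣*∣j∣ (+ P) (gram φ S₀ i j)) ⟨
        ∣ + P * gram φ S₀ i j ∣ ℕ.* β    ≡⟨ cong (λ z → ∣ z ∣ ℕ.* β) balanced ⟨
        ∣ + P * gram φ S₀ i j - + M * ΣV (test q t (gates i j)) ∣ ℕ.* β  ≤⟨ discrepancy i j ⟩
        Q ℕ.* (P ℕ.* α ℕ.* M)            ≡⟨ ring Q P α M ⟩
        P ℕ.* (Q ℕ.* (α ℕ.* M))          ∎)
        where
        open ℕP.≤-Reasoning
        ring : ∀ q p a m → q ℕ.* (p ℕ.* a ℕ.* m) ≡ p ℕ.* (q ℕ.* (a ℕ.* m))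
        ring = ℕR.solve-∀
        balanced : + P * gram φ S₀ i j - + M * ΣV (test q t (gates i j)) ≡ + P * gram φ S₀ i j
        balanced with ¬∀⟶∃¬ t (λ a → finToFun {b} {t} i a ≡ finToFun j a) (λ a → finToFun {b} {t} i a Fin.≟ finToFun j a)
                            (λ eq → i≢j (finToFun-injective i j eq))
        ... | a , ne = trans
          (cong (λ w → + P * gram φ S₀ i j - + M * w)
                (ΣV-test-distinct q t (gates i j) a (Separates.distinct (proj₂ (gate (finToFun i a) (finToFun j a))) ne)))
          (simplify (+ P * gram φ S₀ i j) (+ M))
          where
          simplify : ∀ x m → x - m * 0ℤ ≡ x
          simplify = solve-∀

      -- A diagonal Gram entry is the size of the subcube, so the same estimate places `m` near M Q
      -- / P = M / 2^q.
      diagonal : Fin N → ∣ + (P ℕ.* m) - + (M ℕ.* Q) ∣ ℕ.* β ≤ D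
      diagonal i = subst (λ z → ∣ z ∣ ℕ.* β ≤ D) (cong₂ _-_
          (trans (cong (+ P *_) (gram-diagonal′ S₀)) (sym (ℤP.pos-* P m)))
          (trans (cong (+ M *_) (ΣV-test-same q t (gates i i) λ a →
                    Separates.equal (proj₂ (gate (finToFun i a) (finToFun i a))) refl)) (sym (ℤP.pos-* M Q))))
        (discrepancy i i)
        where
        gram-diagonal′ : ∀ S → gram φ S i i ≡ + length S
        gram-diagonal′ S = gram-agree χ S i i λ _ → refl

      module _ (i : Fin N) (small : 2 ℕ.* (P ℕ.* α) ≤ β) .{{_ : NonZero β}} where

        open ℕP.≤-Reasoning

        private
          2D≤ : 2 ℕ.* D ≤ M ℕ.* Q ℕ.* β
          2D≤ = begin
            2 ℕ.* (Q ℕ.* (P ℕ.* α ℕ.* M))  ≡⟨ ring Q P α M ⟩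
            M ℕ.* Q ℕ.* (2 ℕ.* (P ℕ.* α))  ≤⟨ ℕP.*-monoʳ-≤ (M ℕ.* Q) small ⟩
            M ℕ.* Q ℕ.* β                  ∎
            where
            ring : ∀ q p a m → 2 ℕ.* (q ℕ.* (p ℕ.* a ℕ.* m)) ≡ m ℕ.* q ℕ.* (2 ℕ.* (p ℕ.* a))
            ring = ℕR.solve-∀

        -- As ε ≤ 2^-(k+1), the error in `diagonal` is at most half of the main term.
        subcube-large : M ℕ.* Q ≤ 2 ℕ.* (P ℕ.* m)
        subcube-large = ℕP.*-cancelʳ-≤ (M ℕ.* Q) _ β (ℕP.+-cancelʳ-≤ (M ℕ.* Q ℕ.* β) _ _ (begin
          M ℕ.* Q ℕ.* β ℕ.+ M ℕ.* Q ℕ.* β    ≡⟨ double (M ℕ.* Q) β ⟩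
          2 ℕ.* (M ℕ.* Q ℕ.* β)              ≤⟨ ℕP.*-monoʳ-≤ 2 (begin
              M ℕ.* Q ℕ.* β                      ≤⟨ ℕP.*-monoˡ-≤ β (m≤n+∣+n-+m∣ (M ℕ.* Q) (P ℕ.* m)) ⟩
              (P ℕ.* m ℕ.+ Δ) ℕ.* β              ≡⟨ ℕP.*-distribʳ-+ β (P ℕ.* m) Δ ⟩
              P ℕ.* m ℕ.* β ℕ.+ Δ ℕ.* β          ≤⟨ ℕP.+-monoʳ-≤ _ (diagonal i) ⟩
              P ℕ.* m ℕ.* β ℕ.+ D                ∎) ⟩
          2 ℕ.* (P ℕ.* m ℕ.* β ℕ.+ D)        ≡⟨ ℕP.*-distribˡ-+ 2 (P ℕ.* m ℕ.* β) D ⟩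
          2 ℕ.* (P ℕ.* m ℕ.* β) ℕ.+ 2 ℕ.* D  ≤⟨ ℕP.+-mono-≤ (ℕP.≤-reflexive (sym (ℕP.*-assoc 2 (P ℕ.* m) β))) 2D≤ ⟩
          2 ℕ.* (P ℕ.* m) ℕ.* β ℕ.+ M ℕ.* Q ℕ.* β ∎))
          where
          Δ = ∣ + (P ℕ.* m) - + (M ℕ.* Q) ∣
          double : ∀ x b → x ℕ.* b ℕ.+ x ℕ.* b ≡ 2 ℕ.* (x ℕ.* b)
          double = ℕR.solve-∀

        subcube-small : P ℕ.* m ≤ 2 ℕ.* (M ℕ.* Q)
        subcube-small = ℕP.*-cancelʳ-≤ (P ℕ.* m) _ β (begin
          P ℕ.* m ℕ.* β                      ≤⟨ ℕP.*-monoˡ-≤ β (m≤n+∣+m-+n∣ (P ℕ.* m) (M ℕ.* Q)) ⟩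
          (M ℕ.* Q ℕ.+ Δ) ℕ.* β              ≡⟨ ℕP.*-distribʳ-+ β (M ℕ.* Q) Δ ⟩
          M ℕ.* Q ℕ.* β ℕ.+ Δ ℕ.* β          ≤⟨ ℕP.+-monoʳ-≤ _ (ℕP.≤-trans (diagonal i) (ℕP.≤-trans (ℕP.m≤m+n D _) 2D≤)) ⟩
          M ℕ.* Q ℕ.* β ℕ.+ M ℕ.* Q ℕ.* β    ≡⟨ double (M ℕ.* Q) β ⟩
          2 ℕ.* (M ℕ.* Q) ℕ.* β              ∎)
          where
          Δ = ∣ + (P ℕ.* m) - + (M ℕ.* Q) ∣
          double : ∀ x b → x ℕ.* b ℕ.+ x ℕ.* b ≡ 2 ℕ.* x ℕ.* b
          double = ℕR.solve-∀

        -- The absolute correlation is at most 4^t ε M and `m` is at least 4^t M / 2^(k+1). In the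
        -- quotient 4^t cancels and 2^(k+1) ε remains.
        correlation-small : ∀ i j → i ≢ j → ∣ gram φ S₀ i j ∣ ℕ.* β ≤ 2 ℕ.* (P ℕ.* α) ℕ.* m
        correlation-small i j i≢j = begin
          ∣ gram φ S₀ i j ∣ ℕ.* β       ≤⟨ off-diagonal i j i≢j ⟩
          Q ℕ.* (α ℕ.* M)              ≡⟨ ring₁ Q α M ⟩
          α ℕ.* (M ℕ.* Q)              ≤⟨ ℕP.*-monoʳ-≤ α subcube-large ⟩
          α ℕ.* (2 ℕ.* (P ℕ.* m))      ≡⟨ ring₂ α P m ⟩
          2 ℕ.* (P ℕ.* α) ℕ.* m        ∎
          where
          ring₁ : ∀ q a m → q ℕ.* (a ℕ.* m) ≡ a ℕ.* (m ℕ.* q)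
          ring₁ = ℕR.solve-∀
          ring₂ : ∀ a p m → a ℕ.* (2 ℕ.* (p ℕ.* m)) ≡ 2 ℕ.* (p ℕ.* a) ℕ.* m
          ring₂ = ℕR.solve-∀

-- Choice of the parameters and the bound in natural numbers

module Counting where

  open import Defs using (Polynomial; eval; StrictlyIncreasing)
  open import Data.Bool using (Bool)
  open import Data.Empty using (⊥-elim)
  open import Data.Fin using (Fin; zero; funToFin)
  import Data.Fin as Fin
  open import Data.Integer using (∣_∣; +_)
  import Data.Integer as ℤ
  open import Data.List using (List; []; _∷_; length)
  open import Data.Nat.ListAction using (sum)
  open import Data.Nat
  open import Data.Nat.DivMod
  open import Data.Nat.Logarithm
  open import Data.Nat.Properties
  open import Data.Nat.Tactic.RingSolver using (solve-∀)
  open import Data.Product using (_,_)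
  open import Data.Sum using (inj₁; inj₂; [_,_]′)
  open import Data.Vec using (Vec)
  open import Relation.Binary.PropositionalEquality
  open import Relation.Nullary using (yes; no)
  open Kernels using (gram)
  open PairedWords using (^-distrib-*)
  open AlmostOrthogonal
  open Characters
  open Subcubes

  eval≤ : ∀ p n .{{_ : NonZero n}} → eval p n ≤ sum p * n ^ length p
  eval≤ []      n = z≤n
  eval≤ (a ∷ p) n = begin
    a + n * eval p n                     ≤⟨ +-mono-≤ (m≤m*n a (n ^ suc (length p)) {{m^n≢0 n (suc (length p))}}) (*-monoʳ-≤ n (eval≤ p n)) ⟩
    a * n ^ suc (length p) + n * (sum p * n ^ length p)  ≡⟨ ring a n (sum p) (n ^ length p) ⟩
    (a + sum p) * n ^ suc (length p)     ∎
    where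
    open ≤-Reasoning
    ring : ∀ a n s x → a * (n * x) + n * (s * x) ≡ (a + s) * (n * x)
    ring = solve-∀

  module _ {n : ℕ} (k α β : ℕ) (S : List (Vec Bool n)) where

    -- The condition for ε = α/β, multiplied by `2 ^ k * length S * β`.
    AlmostIndependentℕ : Set
    AlmostIndependentℕ = ∀ (i : Fin k → Fin n) → StrictlyIncreasing i → ∀ σ →
      ∣ + (2 ^ k) ℤ.* + count i S σ ℤ.- + length S ∣ * β ≤ 2 ^ k * α * length S

  module _ (b′ rest q t : ℕ) where

    open Subcube b′ rest q t

    -- With ε = α/β, the correlations are at most γ/β where γ = 2^(k+1) α.  They are weakened
    -- to Cγ/β so that N ≥ (β/Cγ)².  The number ℓ is ⌈log₂ n⌉, and n ≤ N^5.
    subcube-bound : ∀ (S : List (Vec Bool n)) α β L C ℓ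
      .{{_ : NonZero (length S)}} .{{_ : NonZero α}} .{{_ : NonZero C}} → 1 ≤ L →
      AlmostIndependentℕ k α β S → 2 * (2 ^ k * α) < β → β ≤ 2 * (2 ^ k * α) * 2 ^ L →
      β * β ≤ N * (C * (2 * (2 ^ k * α)) * (C * (2 * (2 ^ k * α)))) →
      (∀ x → N ≤ 2 ^ x → ℓ ≤ 5 * x) →
      ℓ * (β * β) ≤ 1280 * (C * C) * 4 ^ t * (length S * (2 ^ k * (α * α) * L))
    subcube-bound S α β L C ℓ 1≤L almost γ<β β≤γ2^L β²≤ ℓ≤ = bound
      where
      open ≤-Reasoning
      P = 2 ^ k
      Q = 4 ^ t
      M = length S
      γ = 2 * (P * α)
      S₀ = subcube S
      m = length S₀
      i₀ : Fin N
      i₀ = funToFin {t} {b} (λ _ → zero)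
      instance
        β≢0 : NonZero β
        β≢0 = >-nonZero (≤-<-trans z≤n γ<β)
        γ≢0 : NonZero γ
        γ≢0 = m*n≢0 2 (P * α) {{_}} {{m*n≢0 P α {{m^n≢0 2 k}}}}
        Cγ≢0 : NonZero (C * γ)
        Cγ≢0 = m*n≢0 C γ
        N≢0 : NonZero N
        N≢0 = m^n≢0 b t

      large : M * Q ≤ 2 * (P * m)
      large = subcube-large S α β almost i₀ (<⇒≤ γ<β)

      small : P * m ≤ 2 * (M * Q)
      small = subcube-small S α β almost i₀ (<⇒≤ γ<β)

      correlation : ∀ i j → i ≢ j → ∣ gram φ S₀ i j ∣ * β ≤ γ * m
      correlation = correlation-small S α β almost i₀ (<⇒≤ γ<β)

      m≢0 : NonZero m
      m≢0 = ≢-nonZero λ m≡0 → <⇒≱ (*-mono-≤ (>-nonZero⁻¹ M) (m^n>0 4 t))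
        (≤-trans large (≤-reflexive (trans (cong (λ z → 2 * (P * z)) m≡0) (cong (2 *_) (*-zeroʳ P)))))

      separated : ∀ i j → gram φ S₀ i j ≡ + m → i ≡ j
      separated i j eq with i Fin.≟ j
      ... | yes i≡j = i≡j
      ... | no  i≢j = ⊥-elim (<⇒≱ (*-monoˡ-< m {{m≢0}} γ<β)
        (subst (_≤ γ * m) (trans (cong (λ z → ∣ z ∣ * β) eq) (*-comm m β)) (correlation i j i≢j)))

      N≤2^m : N ≤ 2 ^ m
      N≤2^m = distinct⇒≤2^ χ S₀ separated

      -- The gain from the subcube: γ² carries `P * P`, but `P * m` is at most `2 * (M * Q)`, so
      -- only one `P` survives.
      γ²m≤ : γ * γ * m ≤ 8 * Q * (M * (P * (α * α)))
      γ²m≤ = begin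
        γ * γ * m                          ≡⟨ ring₁ P α m ⟩
        4 * (α * α) * P * (P * m)          ≤⟨ *-monoʳ-≤ (4 * (α * α) * P) small ⟩
        4 * (α * α) * P * (2 * (M * Q))    ≡⟨ ring₂ (α * α) P M Q ⟩
        8 * Q * (M * (P * (α * α)))        ∎
        where
        ring₁ : ∀ p a m → 2 * (p * a) * (2 * (p * a)) * m ≡ 4 * (a * a) * p * (p * m)
        ring₁ = solve-∀
        ring₂ : ∀ a p m q → 4 * a * p * (2 * (m * q)) ≡ 8 * q * (m * (p * a))
        ring₂ = solve-∀

      -- 160 = 5 * 4 * 8, from the 5 in `ℓ≤`, the exponent `4 * r * L` and the 8 of the moment
      -- bound. The 8 in `γ²m≤` raises it to 1280.
      finish : 160 * L * (C * γ * (C * γ) * m) ≤ 1280 * (C * C) * Q * (M * (P * (α * α) * L))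
      finish = begin
        160 * L * (C * γ * (C * γ) * m)                    ≡⟨ ring₁ 160 L C γ m ⟩
        160 * L * (C * C) * (γ * γ * m)                    ≤⟨ *-monoʳ-≤ (160 * L * (C * C)) γ²m≤ ⟩
        160 * L * (C * C) * (8 * Q * (M * (P * (α * α))))  ≡⟨ ring₂ 160 8 L (C * C) Q M P (α * α) ⟩
        1280 * (C * C) * Q * (M * (P * (α * α) * L))       ∎
        where
        ring₁ : ∀ c l k g m → c * l * (k * g * (k * g) * m) ≡ c * l * (k * k) * (g * g * m)
        ring₁ = solve-∀
        ring₂ : ∀ c d l k q m p a → c * l * k * (d * q * (m * (p * a))) ≡ c * d * k * q * (m * (p * a * l))
        ring₂ = solve-∀

      goal : Set
      goal = ℓ * (β * β) ≤ 1280 * (C * C) * Q * (M * (P * (α * α) * L))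

      weak-correlation : 2 * (C * γ) ≤ β → goal
      weak-correlation 2Cγ≤β =
        let r , N<2^4rL , rβ²≤ = approximately-orthogonal-bound φ (λ i s → sgn² (χ i s)) S₀ (C * γ) β
              (λ i j i≢j → ≤-trans (correlation i j i≢j) (*-monoˡ-≤ m (m≤n*m γ C))) L 2Cγ≤β β²≤
              (≤-trans β≤γ2^L (*-monoˡ-≤ (2 ^ L) (m≤n*m γ C))) N≤2^m
        in begin
        ℓ * (β * β)                            ≤⟨ *-monoˡ-≤ (β * β) (ℓ≤ (4 * r * L) (<⇒≤ N<2^4rL)) ⟩
        5 * (4 * r * L) * (β * β)              ≡⟨ ring₁ 5 4 r L (β * β) ⟩
        20 * L * (r * (β * β))                 ≤⟨ *-monoʳ-≤ (20 * L) rβ²≤ ⟩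
        20 * L * (8 * (C * γ * (C * γ)) * m)   ≡⟨ ring₂ 20 8 L (C * γ * (C * γ)) m ⟩
        160 * L * (C * γ * (C * γ) * m)        ≤⟨ finish ⟩
        1280 * (C * C) * Q * (M * (P * (α * α) * L)) ∎
        where
        ring₁ : ∀ a a′ r l b → a * (a′ * r * l) * b ≡ a * a′ * l * (r * b)
        ring₁ = solve-∀
        ring₂ : ∀ a a′ l g m → a * l * (a′ * g * m) ≡ a * a′ * l * (g * m)
        ring₂ = solve-∀

      -- Here γ/β is at least the constant 1/(2C), so replacing β² by a multiple of γ² costs only a
      -- constant, and the distinctness of the sign vectors, N ≤ 2^m, is enough.
      strong-correlation : β ≤ 2 * (C * γ) → goal
      strong-correlation β≤ = begin
        ℓ * (β * β)
          ≤⟨ *-mono-≤ (ℓ≤ m N≤2^m) (*-mono-≤ β≤ β≤) ⟩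
        5 * m * (2 * (C * γ) * (2 * (C * γ)))
          ≡⟨ ring 5 2 m (C * γ) ⟩
        20 * (C * γ * (C * γ) * m)
          ≤⟨ *-monoˡ-≤ (C * γ * (C * γ) * m) (≤-trans (m≤m*n 20 8) (m≤m*n 160 L {{>-nonZero 1≤L}})) ⟩
        160 * L * (C * γ * (C * γ) * m)
          ≤⟨ finish ⟩
        1280 * (C * C) * Q * (M * (P * (α * α) * L)) ∎
        where
        ring : ∀ a b m g → a * m * (b * g * (b * g)) ≡ a * (b * b) * (g * g * m)
        ring = solve-∀

      bound : goal
      bound = [ weak-correlation , strong-correlation ]′ (≤-total (2 * (C * γ)) β)

  -- `S` lives in `Vec Bool n` for a given `n`, whereas the subcube construction builds its
  -- dimensions as sums; the equations are eliminated here once and for all.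
  blocks-bound : ∀ {n k} b t rest q → q + t * 2 ≡ k → n ≡ q + (b * t + rest) → 2 ≤ b →
    (S : List (Vec Bool n)) → ∀ α β L C ℓ
    .{{_ : NonZero (length S)}} .{{_ : NonZero α}} .{{_ : NonZero C}} → 1 ≤ L →
    AlmostIndependentℕ k α β S → 2 * (2 ^ k * α) < β → β ≤ 2 * (2 ^ k * α) * 2 ^ L →
    β * β ≤ b ^ t * (C * (2 * (2 ^ k * α)) * (C * (2 * (2 ^ k * α)))) →
    (∀ x → b ^ t ≤ 2 ^ x → ℓ ≤ 5 * x) →
    ℓ * (β * β) ≤ 1280 * (C * C) * 4 ^ t * (length S * (2 ^ k * (α * α) * L))
  blocks-bound (suc (suc b′)) t rest q refl n≡ (s≤s (s≤s z≤n))
    with trans n≡ (cong (λ z → q + z) (sym (size≡ t)))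
    where
    open Blocks b′ rest using (b; size)
    size≡ : ∀ t → size t ≡ b * t + rest
    size≡ zero    = cong (_+ rest) (sym (*-zeroʳ b))
    size≡ (suc t) = trans (cong (λ z → b + z) (size≡ t)) (trans (sym (+-assoc b (b * t) rest)) (cong (_+ rest) (sym (*-suc b t))))
  ... | refl = subcube-bound b′ rest q t

  -- `D` caps `t`: twice the length of `p` lets `n ^ D` dominate the square of `p`, up to its
  -- coefficients, and `suc` keeps `D` positive for the empty list. `C` collects those coefficients
  -- and the loss in passing from `n` to `b` by n ≤ 4tb; `4 ^ D` covers the factor `4 ^ t`.
  constant : Polynomial → ℕ
  constant p = let D = 2 * suc (length p); C = suc (sum p) * (4 * D) ^ D in 1280 * (C * C) * 4 ^ D

  constant≢0 : ∀ p → NonZero (constant p)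
  constant≢0 p = m*n≢0 _ (4 ^ D) {{m*n≢0 1280 _ {{_}} {{m*n≢0 C C {{C≢0}} {{C≢0}}}}}} {{m^n≢0 4 D}}
    where
    D = 2 * suc (length p)
    C = suc (sum p) * (4 * D) ^ D
    C≢0 : NonZero C
    C≢0 = m*n≢0 (suc (sum p)) _ {{_}} {{m^n≢0 (4 * D) D}}

  module _ (p : Polynomial) {n k : ℕ} (α β L : ℕ) (S : List (Vec Bool n))
           .{{_ : NonZero (length S)}} .{{α≢0 : NonZero α}} where

    size-bound : 1 ≤ L →
      AlmostIndependentℕ k α β S → β ≤ eval p n * α → 2 * (2 ^ k * α) < β → 2 * k < n →
      β * β ≤ α * α * n ^ ⌊ k /2⌋ → β ≤ 2 * (2 ^ k * α) * 2 ^ L →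
      ⌈log₂ n ⌉ * (β * β) ≤ constant p * (length S * (2 ^ k * (α * α) * L))
    size-bound 1≤L almost β≤pα γ<β 2k<n β²≤α²n^ β≤γ2^L =
      ≤-trans
        (blocks-bound b t rest q (m∸n+n≡m (subst (_≤ k) (*-comm 2 t) 2t≤k)) n≡ (≤-trans (s≤s (s≤s z≤n)) 4≤b)
          S α β L C ⌈log₂ n ⌉ 1≤L almost γ<β β≤γ2^L β²≤N log-bound)
        (*-monoˡ-≤ _ (*-monoʳ-≤ (1280 * (C * C)) (^-monoʳ-≤ 4 (m⊓n≤m D ⌊ k /2⌋))))
      where
      open ≤-Reasoning
      D = 2 * suc (length p)
      C = suc (sum p) * (4 * D) ^ D
      t = D ⊓ ⌊ k /2⌋

      α<β : α < β
      α<β = ≤-<-trans (≤-trans (m≤n*m α (2 ^ k) {{m^n≢0 2 k}}) (m≤n*m (2 ^ k * α) 2)) γ<β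

      -- For k ≤ 1 the last power of `n` is 1 and the hypothesis would read β² ≤ α², against ε < 1.
      1≤⌊k/2⌋ : 1 ≤ ⌊ k /2⌋
      1≤⌊k/2⌋ = n≢0⇒n>0 λ eq → <⇒≱ (*-mono-< α<β α<β)
        (subst (β * β ≤_) (trans (cong (λ e → α * α * n ^ e) eq) (*-identityʳ (α * α))) β²≤α²n^)

      1≤t : 1 ≤ t
      1≤t = ⊓-glb (s≤s z≤n) 1≤⌊k/2⌋

      instance
        t≢0 : NonZero t
        t≢0 = >-nonZero 1≤t
        n≢0 : NonZero n
        n≢0 = >-nonZero (≤-<-trans z≤n 2k<n)

      2t≤k : 2 * t ≤ k
      2t≤k = begin
        2 * t                   ≤⟨ *-monoʳ-≤ 2 (m⊓n≤n D ⌊ k /2⌋) ⟩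
        2 * ⌊ k /2⌋             ≡⟨ cong (λ z → ⌊ k /2⌋ + z) (+-identityʳ ⌊ k /2⌋) ⟩
        ⌊ k /2⌋ + ⌊ k /2⌋       ≤⟨ +-monoʳ-≤ ⌊ k /2⌋ (⌊n/2⌋≤⌈n/2⌉ k) ⟩
        ⌊ k /2⌋ + ⌈ k /2⌉       ≡⟨ ⌊n/2⌋+⌈n/2⌉≡n k ⟩
        k                       ∎

      q = k ∸ t * 2
      w = n ∸ q
      b = w / t
      rest = w % t

      q≤k : q ≤ k
      q≤k = m∸n≤m k (t * 2)

      k≤n : k ≤ n
      k≤n = ≤-trans (m≤m+n k _) (<⇒≤ 2k<n)

      n≡ : n ≡ q + (b * t + rest)
      n≡ = sym (trans (cong (λ z → q + z) (trans (+-comm (b * t) rest) (sym (m≡m%n+[m/n]*n w t))))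
                      (m+[n∸m]≡n (≤-trans q≤k k≤n)))

      -- n - q ≥ 2k - q = k + 2t ≥ 4t.
      4t≤w : 4 * t ≤ w
      4t≤w = begin
        4 * t             ≡⟨ ring t ⟩
        2 * t + t * 2     ≤⟨ +-monoˡ-≤ (t * 2) 2t≤k ⟩
        k + t * 2         ≡⟨ m+n∸n≡m (k + t * 2) q ⟨
        k + t * 2 + q ∸ q ≡⟨ cong (_∸ q) (trans (+-assoc k (t * 2) q) (cong (λ z → k + z) (trans (+-comm (t * 2) q) (m∸n+n≡m (subst (_≤ k) (*-comm 2 t) 2t≤k))))) ⟩
        k + k ∸ q         ≤⟨ ∸-monoˡ-≤ q (subst (_≤ n) (cong (λ z → k + z) (+-identityʳ k)) (<⇒≤ 2k<n)) ⟩
        w                 ∎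
        where
        ring : ∀ t → 4 * t ≡ 2 * t + t * 2
        ring = solve-∀

      4≤b : 4 ≤ b
      4≤b = subst (_≤ b) (m*n/n≡m 4 t) (/-monoˡ-≤ t 4t≤w)

      -- Since q ≤ k < n/2, at least half of the coordinates lie beyond the prefix; the remainder of
      -- their division into blocks is below t ≤ bt.
      n≤4tb : n ≤ 4 * t * b
      n≤4tb = begin
        n                        ≤⟨ +-cancelʳ-≤ n _ _ (begin
            n + n                  ≤⟨ +-mono-≤ (m≤n+m∸n n q) (m≤n+m∸n n q) ⟩
            q + w + (q + w)        ≡⟨ ring₀ q w ⟩
            2 * q + 2 * w          ≤⟨ +-monoˡ-≤ (2 * w) (≤-trans (*-monoʳ-≤ 2 q≤k) (<⇒≤ 2k<n)) ⟩
            n + 2 * w              ≡⟨ +-comm n (2 * w) ⟩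
            2 * w + n              ∎) ⟩
        2 * w                    ≡⟨ cong (2 *_) (m≡m%n+[m/n]*n w t) ⟩
        2 * (rest + b * t)       ≤⟨ *-monoʳ-≤ 2 (+-monoˡ-≤ (b * t) (≤-trans (<⇒≤ (m%n<n w t)) (m≤n*m t b {{>-nonZero (≤-trans (s≤s z≤n) 4≤b)}}))) ⟩
        2 * (b * t + b * t)      ≡⟨ ring₁ b t ⟩
        4 * t * b                ∎
        where
        ring₀ : ∀ q w → q + w + (q + w) ≡ 2 * q + 2 * w
        ring₀ = solve-∀
        ring₁ : ∀ b t → 2 * (b * t + b * t) ≡ 4 * t * b
        ring₁ = solve-∀

      instance
        b≢0 : NonZero b
        b≢0 = >-nonZero (≤-trans (s≤s z≤n) 4≤b)

      -- The 5 is 4 + 1: `4 * t` is below `2 ^ (4 * t)` and so below `b ^ (4 * t)`, and the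
      -- remaining factor `b` is at most `b ^ t`.
      log-bound : ∀ x → b ^ t ≤ 2 ^ x → ⌈log₂ n ⌉ ≤ 5 * x
      log-bound x N≤2^x = subst (⌈log₂ n ⌉ ≤_) (⌈log₂2^n⌉≡n (5 * x)) (⌈log₂⌉-mono-≤ (begin
        n                     ≤⟨ n≤4tb ⟩
        4 * t * b             ≤⟨ *-monoˡ-≤ b (≤-trans (<⇒≤ (n<2^n (4 * t))) (^-monoˡ-≤ (4 * t) (≤-trans (s≤s (s≤s z≤n)) 4≤b))) ⟩
        b ^ (4 * t) * b       ≤⟨ *-monoʳ-≤ (b ^ (4 * t)) (subst (_≤ b ^ t) (*-identityʳ b) (^-monoʳ-≤ b 1≤t)) ⟩
        b ^ (4 * t) * b ^ t   ≡⟨ ^-distribˡ-+-* b (4 * t) t ⟨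
        b ^ (4 * t + t)       ≡⟨ cong (b ^_) (ring t) ⟩
        b ^ (t * 5)           ≡⟨ ^-*-assoc b t 5 ⟨
        (b ^ t) ^ 5           ≤⟨ ^-monoˡ-≤ 5 N≤2^x ⟩
        (2 ^ x) ^ 5           ≡⟨ ^-*-assoc 2 x 5 ⟩
        2 ^ (x * 5)           ≡⟨ cong (2 ^_) (*-comm x 5) ⟩
        2 ^ (5 * x)           ∎))
        where
        ring : ∀ t → 4 * t + t ≡ t * 5
        ring = solve-∀

      c = suc (sum p)
      E = (4 * D) ^ D
      instance
        C≢0 : NonZero C
        C≢0 = m*n≢0 c E {{_}} {{m^n≢0 (4 * D) D}}

      -- If the minimum `t` is ⌊k/2⌋, this is the hypothesis on n^⌊k/2⌋. If it is `D`, the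
      -- polynomial bound on 1/ε is squared, and twice its exponent is at most `D`.
      β²≤c²α²n^t : β * β ≤ c * c * (α * α) * n ^ t
      β²≤c²α²n^t with ⊓-sel D ⌊ k /2⌋
      ... | inj₂ t≡ = begin
        β * β                        ≤⟨ β²≤α²n^ ⟩
        α * α * n ^ ⌊ k /2⌋          ≡⟨ cong (λ e → α * α * n ^ e) t≡ ⟨
        α * α * n ^ t                ≤⟨ *-monoˡ-≤ (n ^ t) (m≤n*m (α * α) (c * c)) ⟩
        c * c * (α * α) * n ^ t      ∎
      ... | inj₁ t≡ = begin
        β * β                        ≤⟨ *-mono-≤ β≤ β≤ ⟩
        c * X * α * (c * X * α)      ≡⟨ ring c X α ⟩
        c * c * (α * α) * (X * X)    ≡⟨ cong (c * c * (α * α) *_) (^-distribˡ-+-* n d d) ⟨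
        c * c * (α * α) * n ^ (d + d)  ≤⟨ *-monoʳ-≤ (c * c * (α * α)) (^-monoʳ-≤ n (begin
            d + d      ≡⟨ cong (λ z → d + z) (+-identityʳ d) ⟨
            2 * d      ≤⟨ *-monoʳ-≤ 2 (n≤1+n d) ⟩
            D          ≡⟨ t≡ ⟨
            t          ∎)) ⟩
        c * c * (α * α) * n ^ t      ∎
        where
        d = length p
        X = n ^ d
        β≤ : β ≤ c * X * α
        β≤ = ≤-trans β≤pα (*-monoˡ-≤ α (≤-trans (eval≤ p n) (*-monoˡ-≤ X (n≤1+n (sum p)))))
        ring : ∀ c x a → c * x * a * (c * x * a) ≡ c * c * (a * a) * (x * x)
        ring = solve-∀

      β²≤N : β * β ≤ b ^ t * (C * (2 * (2 ^ k * α)) * (C * (2 * (2 ^ k * α))))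
      β²≤N = begin
        β * β                                ≤⟨ β²≤c²α²n^t ⟩
        c * c * (α * α) * n ^ t              ≤⟨ *-monoʳ-≤ (c * c * (α * α)) (begin
            n ^ t                              ≤⟨ ^-monoˡ-≤ t n≤4tb ⟩
            (4 * t * b) ^ t                    ≡⟨ ^-distrib-* (4 * t) b t ⟩
            (4 * t) ^ t * b ^ t                ≤⟨ *-monoˡ-≤ (b ^ t) (≤-trans (^-monoˡ-≤ t (*-monoʳ-≤ 4 t≤D)) (^-monoʳ-≤ (4 * D) t≤D)) ⟩
            -- Squared to fit into `C * C`.
            E * b ^ t                          ≤⟨ *-monoˡ-≤ (b ^ t) (m≤m*n E E {{m^n≢0 (4 * D) D}}) ⟩
            E * E * b ^ t                      ∎) ⟩
        c * c * (α * α) * (E * E * b ^ t)    ≡⟨ ring c α E (b ^ t) ⟩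
        b ^ t * (C * α * (C * α))            ≤⟨ *-monoʳ-≤ (b ^ t) (*-mono-≤ Cα≤ Cα≤) ⟩
        b ^ t * (C * (2 * (2 ^ k * α)) * (C * (2 * (2 ^ k * α)))) ∎
        where
        t≤D : t ≤ D
        t≤D = m⊓n≤m D ⌊ k /2⌋
        Cα≤ : C * α ≤ C * (2 * (2 ^ k * α))
        Cα≤ = *-monoʳ-≤ C (≤-trans (m≤n*m α (2 ^ k) {{m^n≢0 2 k}}) (m≤n*m (2 ^ k * α) 2))
        ring : ∀ c a e n → c * c * (a * a) * (e * e * n) ≡ n * (c * e * a * (c * e * a))
        ring = solve-∀

-- Passage between rationals and natural numbers

module Fractions where

  open import Defs
  open import Data.Bool using (Bool)
  open import Data.Integer using (ℤ; +_; -[1+_]; +≤+)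
  import Data.Integer as ℤ
  import Data.Integer.DivMod as ℤ
  import Data.Integer.Properties as ℤP
  open import Data.List using (List; length)
  open import Data.Nat as ℕ using (ℕ; zero; suc; z≤n; s≤s; ⌊_/2⌋)
  import Data.Nat.Properties as ℕP
  import Data.Nat.Coprimality as Coprimality
  open import Data.Nat.Logarithm
  open import Data.Rational
  import Data.Rational.Unnormalised as ℚᵘ
  import Data.Rational.Unnormalised.Properties as ℚᵘP
  open import Data.Rational.Properties
  open import Data.Rational.Solver using (module +-*-Solver)
  open +-*-Solver
  open import Algebra.Properties.Group +-0-group using () renaming (⁻¹-involutive to neg-involutive)
  open import Data.Vec using (Vec)
  open import Relation.Binary.PropositionalEquality
  open Characters using (count)
  open Counting

  ι : ℤ → ℚ
  ι z = z / 1

  -- Division by 1 normalises through a gcd and is stuck on a variable; with the explicit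
  -- constructor, arithmetic and order on ℚ compute.
  ι≡mkℚ : ∀ z → ι z ≡ mkℚ z 0 (Coprimality.sym (Coprimality.1-coprimeTo ℤ.∣ z ∣))
  ι≡mkℚ z = ↥p/↧p≡p (mkℚ z 0 (Coprimality.sym (Coprimality.1-coprimeTo ℤ.∣ z ∣)))

  ι-* : ∀ x y → ι (x ℤ.* y) ≡ ι x * ι y
  ι-* x y = sym (cong₂ _*_ (ι≡mkℚ x) (ι≡mkℚ y))

  ι-neg : ∀ x → ι (ℤ.- x) ≡ - ι x
  ι-neg (+ zero)  = refl
  ι-neg (+ suc n) = refl
  ι-neg -[1+ n ]  = sym (neg-involutive (ι (+ suc n)))

  ι-sub : ∀ x y → ι (x ℤ.- y) ≡ ι x - ι y
  ι-sub x y = begin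
    ι (x ℤ.+ ℤ.- y)                          ≡⟨ cong₂ (λ a b → ι (a ℤ.+ b)) (sym (ℤP.*-identityʳ x)) (sym (ℤP.*-identityʳ (ℤ.- y))) ⟩
    ι (x ℤ.* + 1 ℤ.+ (ℤ.- y) ℤ.* + 1)        ≡⟨ cong₂ _+_ (ι≡mkℚ x) (ι≡mkℚ (ℤ.- y)) ⟨
    ι x + ι (ℤ.- y)                          ≡⟨ cong (λ z → ι x + z) (ι-neg y) ⟩
    ι x - ι y                                ∎
    where open ≡-Reasoning

  ι-∣∣ : ∀ x → ∣ ι x ∣ ≡ ι (+ ℤ.∣ x ∣)
  ι-∣∣ x = trans (cong ∣_∣ (ι≡mkℚ x)) (sym (ι≡mkℚ (+ ℤ.∣ x ∣)))

  ι-mono-≤ : ∀ {x y} → x ℤ.≤ y → ι x ≤ ι y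
  ι-mono-≤ {x} {y} x≤y rewrite ι≡mkℚ x | ι≡mkℚ y = *≤* (ℤP.*-monoʳ-≤-nonNeg (+ 1) x≤y)

  ι-cancel-≤ : ∀ {x y} → ι x ≤ ι y → x ℤ.≤ y
  ι-cancel-≤ {x} {y} le rewrite ι≡mkℚ x | ι≡mkℚ y with le
  ... | *≤* p = ℤP.*-cancelʳ-≤-pos x y (+ 1) p

  ι-cancel-< : ∀ {x y} → ι x < ι y → x ℤ.< y
  ι-cancel-< {x} {y} lt rewrite ι≡mkℚ x | ι≡mkℚ y with lt
  ... | *<* p = ℤP.*-cancelʳ-<-nonNeg (+ 1) p

  fromℕ-* : ∀ x y → fromℕ (x ℕ.* y) ≡ fromℕ x * fromℕ y
  fromℕ-* x y = trans (cong ι (ℤP.pos-* x y)) (ι-* (+ x) (+ y))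

  fromℕ-mono-≤ : ∀ {x y} → x ℕ.≤ y → fromℕ x ≤ fromℕ y
  fromℕ-mono-≤ x≤y = ι-mono-≤ (+≤+ x≤y)

  fromℕ-cancel-≤ : ∀ {x y} → fromℕ x ≤ fromℕ y → x ℕ.≤ y
  fromℕ-cancel-≤ le = ℤP.drop‿+≤+ (ι-cancel-≤ le)

  fromℕ-nonNeg : ∀ x → NonNegative (fromℕ x)
  fromℕ-nonNeg x = normalize-nonNeg x 1

  fromℕ-pos : ∀ x .{{_ : ℕ.NonZero x}} → Positive (fromℕ x)
  fromℕ-pos x = normalize-pos x 1

  /-*-cancel : ∀ z d .{{_ : ℕ.NonZero d}} → (z / d) * fromℕ d ≡ ι z
  /-*-cancel z (suc d) = toℚᵘ-injective (ℚᵘP.≃-trans (toℚᵘ-homo-* (z / suc d) (fromℕ (suc d)))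
    (ℚᵘP.≃-trans (ℚᵘP.*-cong (toℚᵘ-fromℚᵘ (ℚᵘ.mkℚᵘ z d)) (toℚᵘ-fromℚᵘ (ℚᵘ.mkℚᵘ (+ suc d) 0)))
      (ℚᵘP.≃-trans (ℚᵘ.*≡* eq) (ℚᵘP.≃-sym (toℚᵘ-fromℚᵘ (ℚᵘ.mkℚᵘ z 0))))))
    where
    eq : z ℤ.* + suc d ℤ.* + 1 ≡ z ℤ.* (+ suc d ℤ.* + 1)
    eq = ℤP.*-assoc z (+ suc d) (+ 1)

  -- For p = n/d, z d ≤ n < (⌊p⌋ + 1) d, and `d` cancels.
  ≤-floor : ∀ {z} p → ι z ≤ p → z ℤ.≤ floor p
  ≤-floor {z} p@(mkℚ n d-1 _) le rewrite ι≡mkℚ z with le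
  ... | *≤* z*d≤n = subst (z ℤ.≤_) (ℤP.pred-suc (floor p)) (ℤP.i<j⇒i≤pred[j] {z} {ℤ.suc (floor p)} (ℤP.*-cancelʳ-<-nonNeg {z} {ℤ.suc (floor p)} d (ℤP.≤-<-trans z*d≤n
          (subst₂ ℤ._<_ (sym (ℤP.*-identityʳ n)) (cong (λ f → ℤ.suc f ℤ.* d) (sym (ℤ.div-pos-is-/ℕ n (suc d-1))))
            (ℤ.n<s[n/ℕd]*d n (suc d-1))))))
    where
    d = + suc d-1

  floor-≤ : ∀ p → ι (floor p) ≤ p
  floor-≤ p@(mkℚ n d-1 _) rewrite ι≡mkℚ (floor p) =
    *≤* (subst (floor p ℤ.* + suc d-1 ℤ.≤_) (sym (ℤP.*-identityʳ n)) (ℤ.[n/d]*d≤n n (+ suc d-1)))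

  ceiling≡ : ∀ p → ceiling p ≡ ℤ.- floor (- p)
  ceiling≡ (mkℚ _ _ _) = refl

  ≤-ceiling : ∀ p → p ≤ ι (ceiling p)
  ≤-ceiling p = subst₂ _≤_ (neg-involutive p)
    (trans (sym (ι-neg (floor (- p)))) (cong ι (sym (ceiling≡ p)))) (neg-antimono-≤ (floor-≤ (- p)))

  ceiling-≤ : ∀ {z} p → p ≤ ι z → ceiling p ℤ.≤ z
  ceiling-≤ {z} p p≤z = subst₂ ℤ._≤_ (sym (ceiling≡ p)) (ℤP.neg-involutive z)
    (ℤP.neg-mono-≤ (≤-floor (- p) (subst (_≤ - p) (sym (ι-neg z)) (neg-antimono-≤ p≤z))))

  -- The recursion runs on a bound for the logarithm, which drops by one when `n` is replaced by
  -- ⌈n/2⌉.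
  n≤2^⌈log₂n⌉ : ∀ n → n ℕ.≤ 2 ℕ.^ ⌈log₂ n ⌉
  n≤2^⌈log₂n⌉ n = go ⌈log₂ n ⌉ n ℕP.≤-refl
    where
    open ℕP.≤-Reasoning
    go : ∀ l n → ⌈log₂ n ⌉ ℕ.≤ l → n ℕ.≤ 2 ℕ.^ l
    go l       0               _ = z≤n
    go l       1               _ = ℕP.m^n>0 2 l
    go zero    n@(suc (suc n′)) log≤ with ℕP.≤-trans (⌈log₂⌉-mono-≤ {2} {n} (s≤s (s≤s z≤n))) log≤
    ... | ()
    go (suc l) n@(suc (suc n′)) log≤ = begin
      n                                  ≡⟨ ℕP.⌊n/2⌋+⌈n/2⌉≡n n ⟨
      ⌊ n /2⌋ ℕ.+ ℕ.⌈ n /2⌉              ≤⟨ ℕP.+-monoˡ-≤ ℕ.⌈ n /2⌉ (ℕP.⌊n/2⌋≤⌈n/2⌉ n) ⟩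
      ℕ.⌈ n /2⌉ ℕ.+ ℕ.⌈ n /2⌉            ≤⟨ ℕP.+-mono-≤ half half ⟩
      2 ℕ.^ l ℕ.+ 2 ℕ.^ l                ≡⟨ cong (λ z → 2 ℕ.^ l ℕ.+ z) (ℕP.+-identityʳ (2 ℕ.^ l)) ⟨
      2 ℕ.^ suc l                        ∎
      where
      half : ℕ.⌈ n /2⌉ ℕ.≤ 2 ℕ.^ l
      half = go l ℕ.⌈ n /2⌉ (subst (ℕ._≤ l) (sym (⌈log₂⌈n/2⌉⌉≡⌈log₂n⌉∸1 n)) (ℕP.∸-monoˡ-≤ 1 log≤))

  ≤2^⌈log₂ℚ⌉ : ∀ x → x ≤ fromℕ (2 ℕ.^ ⌈log₂ℚ x ⌉)
  ≤2^⌈log₂ℚ⌉ x = ≤-trans (≤-ceiling x) (ι-mono-≤ (ℤP.≤-trans (i≤∣i∣ (ceiling x)) (+≤+ (n≤2^⌈log₂n⌉ ℤ.∣ ceiling x ∣))))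
    where
    i≤∣i∣ : ∀ i → i ℤ.≤ + ℤ.∣ i ∣
    i≤∣i∣ (+ n)    = ℤP.≤-refl
    i≤∣i∣ -[1+ n ] = ℤ.-≤+

  ⌈log₂ℚ⌉-mono-≤ : ∀ {x y} → 0ℚ ≤ x → x ≤ y → ⌈log₂ℚ x ⌉ ℕ.≤ ⌈log₂ℚ y ⌉
  ⌈log₂ℚ⌉-mono-≤ {x} {y} 0≤x x≤y = ⌈log₂⌉-mono-≤ (∣∣-mono {ceiling x} {ceiling y}
    (ι-cancel-≤ {ℤ.0ℤ} {ceiling x} (≤-trans 0≤x (≤-ceiling x))) (ceiling-≤ x (≤-trans x≤y (≤-ceiling y))))
    where
    ∣∣-mono : ∀ {i j} → ℤ.0ℤ ℤ.≤ i → i ℤ.≤ j → ℤ.∣ i ∣ ℕ.≤ ℤ.∣ j ∣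
    ∣∣-mono (+≤+ _) (+≤+ i≤j) = i≤j

  module _ (ε : ℚ) .{{_ : Positive ε}} where

    private
      α β : ℕ
      α = ℤ.∣ ↥ ε ∣
      β = ↧ₙ ε

      instance
        ε≢0 : NonZero ε
        ε≢0 = pos⇒nonZero ε

    num≢0 : ℕ.NonZero α
    num≢0 = go ε
      where
      go : ∀ ε .{{_ : Positive ε}} → ℕ.NonZero ℤ.∣ ↥ ε ∣
      go (mkℚ (+ suc _) _ _) = _

    εβ≡α : ε * fromℕ β ≡ fromℕ α
    εβ≡α = trans (trans (cong (_* fromℕ β) (sym (↥p/↧p≡p ε))) (/-*-cancel (↥ ε) β {{_}})) (cong ι (go ε))
      where
      go : ∀ ε .{{_ : Positive ε}} → ↥ ε ≡ + ℤ.∣ ↥ ε ∣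
      go (mkℚ (+ suc _) _ _) = refl

    2^-k*2^k : ∀ k → 2^- k * fromℕ (2 ℕ.^ k) ≡ 1ℚ
    2^-k*2^k k = /-*-cancel (+ 1) (2 ℕ.^ k) {{ℕP.m^n≢0 2 k}}

    denominator≤ : ∀ y → 1ℚ ≤ fromℕ y * ε → β ℕ.≤ y ℕ.* α
    denominator≤ y 1≤yε = fromℕ-cancel-≤ (subst₂ _≤_ (*-identityˡ (fromℕ β))
      (trans (*-assoc (fromℕ y) ε (fromℕ β)) (trans (cong (fromℕ y *_) εβ≡α) (sym (fromℕ-* y α))))
      (*-monoʳ-≤-nonNeg (fromℕ β) {{fromℕ-nonNeg β}} 1≤yε))

    ε²β² : ε * ε * fromℕ (β ℕ.* β) ≡ fromℕ (α ℕ.* α)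
    ε²β² = begin
      ε * ε * fromℕ (β ℕ.* β)             ≡⟨ cong (ε * ε *_) (fromℕ-* β β) ⟩
      ε * ε * (fromℕ β * fromℕ β)         ≡⟨ solve 2 (λ e b → e :* e :* (b :* b) := e :* b :* (e :* b)) refl ε (fromℕ β) ⟩
      ε * fromℕ β * (ε * fromℕ β)         ≡⟨ cong₂ _*_ εβ≡α εβ≡α ⟩
      fromℕ α * fromℕ α                   ≡⟨ fromℕ-* α α ⟨
      fromℕ (α ℕ.* α)                     ∎
      where open ≡-Reasoning

    denominator²≤ : ∀ y → 1ℚ ≤ ε * ε * fromℕ y → β ℕ.* β ℕ.≤ α ℕ.* α ℕ.* y
    denominator²≤ y 1≤ = fromℕ-cancel-≤ (subst₂ _≤_ (*-identityˡ (fromℕ (β ℕ.* β))) eq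
      (*-monoʳ-≤-nonNeg (fromℕ (β ℕ.* β)) {{fromℕ-nonNeg (β ℕ.* β)}} 1≤))
      where
      eq : ε * ε * fromℕ y * fromℕ (β ℕ.* β) ≡ fromℕ (α ℕ.* α ℕ.* y)
      eq = trans (solve 3 (λ e y b → e :* y :* b := e :* b :* y) refl (ε * ε) (fromℕ y) (fromℕ (β ℕ.* β)))
                 (trans (cong (_* fromℕ y) ε²β²) (sym (fromℕ-* (α ℕ.* α) y)))

    <denominator : ∀ k → ε < 2^- suc k → 2 ℕ.* (2 ℕ.^ k ℕ.* α) ℕ.< β
    <denominator k ε<2^- = ℤP.drop‿+<+ (ι-cancel-< (subst₂ _<_ lhs rhs
      (*-monoˡ-<-pos (fromℕ β * fromℕ (2 ℕ.^ suc k))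
        {{subst Positive (fromℕ-* β (2 ℕ.^ suc k)) (fromℕ-pos (β ℕ.* 2 ℕ.^ suc k) {{ℕP.m*n≢0 β (2 ℕ.^ suc k) {{_}} {{ℕP.m^n≢0 2 (suc k)}}}})}}
        ε<2^-)))
      where
      open ≡-Reasoning
      lhs : ε * (fromℕ β * fromℕ (2 ℕ.^ suc k)) ≡ fromℕ (2 ℕ.* (2 ℕ.^ k ℕ.* α))
      lhs = begin
        ε * (fromℕ β * fromℕ (2 ℕ.^ suc k))  ≡⟨ *-assoc ε _ _ ⟨
        ε * fromℕ β * fromℕ (2 ℕ.^ suc k)    ≡⟨ cong (_* fromℕ (2 ℕ.^ suc k)) εβ≡α ⟩
        fromℕ α * fromℕ (2 ℕ.^ suc k)        ≡⟨ fromℕ-* α (2 ℕ.^ suc k) ⟨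
        fromℕ (α ℕ.* 2 ℕ.^ suc k)            ≡⟨ cong fromℕ (trans (ℕP.*-comm α _) (ℕP.*-assoc 2 (2 ℕ.^ k) α)) ⟩
        fromℕ (2 ℕ.* (2 ℕ.^ k ℕ.* α))        ∎
      rhs : 2^- suc k * (fromℕ β * fromℕ (2 ℕ.^ suc k)) ≡ fromℕ β
      rhs = trans (solve 3 (λ x b p → x :* (b :* p) := x :* p :* b) refl (2^- suc k) (fromℕ β) (fromℕ (2 ℕ.^ suc k)))
                  (trans (cong (_* fromℕ β) (2^-k*2^k (suc k))) (*-identityˡ (fromℕ β)))

    denominator≤2^log : ∀ k → β ℕ.≤ 2 ℕ.* (2 ℕ.^ k ℕ.* α) ℕ.* 2 ℕ.^ log[1/2^ k +1* ε ]
    denominator≤2^log k = fromℕ-cancel-≤ (subst₂ _≤_ lhs rhs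
      (*-monoʳ-≤-nonNeg (fromℕ γ) {{fromℕ-nonNeg γ}} (≤2^⌈log₂ℚ⌉ (2^- suc k ÷ ε))))
      where
      open ≡-Reasoning
      γ = 2 ℕ.* (2 ℕ.^ k ℕ.* α)
      lhs : (2^- suc k ÷ ε) * fromℕ γ ≡ fromℕ β
      lhs = begin
        2^- suc k * 1/ ε * fromℕ γ                       ≡⟨ cong (λ g → 2^- suc k * 1/ ε * fromℕ g) (ℕP.*-assoc 2 (2 ℕ.^ k) α) ⟨
        2^- suc k * 1/ ε * fromℕ (2 ℕ.^ suc k ℕ.* α)     ≡⟨ cong (2^- suc k * 1/ ε *_) (trans (fromℕ-* (2 ℕ.^ suc k) α) (cong (fromℕ (2 ℕ.^ suc k) *_) (sym εβ≡α))) ⟩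
        2^- suc k * 1/ ε * (fromℕ (2 ℕ.^ suc k) * (ε * fromℕ β))
          ≡⟨ solve 5 (λ x y p e b → x :* y :* (p :* (e :* b)) := x :* p :* (y :* e) :* b) refl
               (2^- suc k) (1/ ε) (fromℕ (2 ℕ.^ suc k)) ε (fromℕ β) ⟩
        2^- suc k * fromℕ (2 ℕ.^ suc k) * (1/ ε * ε) * fromℕ β
          ≡⟨ cong (_* fromℕ β) (cong₂ _*_ (2^-k*2^k (suc k)) (*-inverseˡ ε)) ⟩
        1ℚ * 1ℚ * fromℕ β                                ≡⟨ *-identityˡ (fromℕ β) ⟩
        fromℕ β                                          ∎
      rhs : fromℕ (2 ℕ.^ log[1/2^ k +1* ε ]) * fromℕ γ ≡ fromℕ (γ ℕ.* 2 ℕ.^ log[1/2^ k +1* ε ])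
      rhs = trans (*-comm _ (fromℕ γ)) (sym (fromℕ-* γ _))

    -- A zero logarithm would force 1/(2^(k+1) ε) ≤ 1.
    log-pos : ∀ k → ε < 2^- suc k → 1 ℕ.≤ log[1/2^ k +1* ε ]
    log-pos k ε<2^- = ℕP.n≢0⇒n>0 λ log≡0 → ℕP.<⇒≱ (<denominator k ε<2^-)
      (subst (β ℕ.≤_) (trans (cong (λ l → 2 ℕ.* (2 ℕ.^ k ℕ.* α) ℕ.* 2 ℕ.^ l) log≡0) (ℕP.*-identityʳ _))
        (denominator≤2^log k))

    log-mono : ∀ k → log[1/2^ k +1* ε ] ℕ.≤ log[1/ ε ]
    log-mono k = ⌈log₂ℚ⌉-mono-≤ (subst (_≤ 2^- suc k * 1/ ε) (*-zeroˡ (1/ ε)) (scale (nonNegative⁻¹ (2^- suc k) {{2^-nonNeg}}))) (scale 2^-≤1)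
      where
      scale : ∀ {x y} → x ≤ y → x * 1/ ε ≤ y * 1/ ε
      scale = *-monoʳ-≤-nonNeg (1/ ε) {{pos⇒nonNeg (1/ ε) {{1/pos⇒pos ε}}}}
      2^-nonNeg : NonNegative (2^- suc k)
      2^-nonNeg = normalize-nonNeg 1 (2 ℕ.^ suc k) {{ℕP.m^n≢0 2 (suc k)}}
      2^-≤1 : 2^- suc k ≤ fromℕ 1
      2^-≤1 = *-cancelʳ-≤-pos (fromℕ (2 ℕ.^ suc k)) {{fromℕ-pos (2 ℕ.^ suc k) {{ℕP.m^n≢0 2 (suc k)}}}}
        (subst₂ _≤_ (sym (2^-k*2^k (suc k))) (sym (*-identityˡ _)) (fromℕ-mono-≤ (ℕP.m^n>0 2 (suc k))))

    almost⇒almostℕ : ∀ {n} k (S : List (Vec Bool n)) .{{_ : ℕ.NonZero (length S)}} →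
                     AlmostIndependent k ε S → AlmostIndependentℕ k α β S
    almost⇒almostℕ {n} k S almost i i-incr σ = fromℕ-cancel-≤ (subst₂ _≤_ lhs rhs
        (*-monoʳ-≤-nonNeg (fromℕ M * fromℕ P * fromℕ β) {{scale-nonNeg}} (almost i i-incr σ)))
      where
      open ≡-Reasoning
      M = length S
      P = 2 ℕ.^ k
      c = count i S σ
      Δ = + P ℤ.* + c ℤ.- + M
      MP≡ : fromℕ (M ℕ.* P) ≡ fromℕ M * fromℕ P
      MP≡ = fromℕ-* M P
      scale-nonNeg : NonNegative (fromℕ M * fromℕ P * fromℕ β)
      scale-nonNeg = subst NonNegative (trans (fromℕ-* (M ℕ.* P) β) (cong (_* fromℕ β) MP≡)) (fromℕ-nonNeg (M ℕ.* P ℕ.* β))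
      scaled : (Pr S i σ - 2^- k) * (fromℕ M * fromℕ P) ≡ ι Δ
      scaled = begin
        (Pr S i σ - 2^- k) * (fromℕ M * fromℕ P)
          ≡⟨ solve 4 (λ x y m p → (x :- y) :* (m :* p) := p :* (x :* m) :- y :* p :* m) refl
               (Pr S i σ) (2^- k) (fromℕ M) (fromℕ P) ⟩
        fromℕ P * (Pr S i σ * fromℕ M) - 2^- k * fromℕ P * fromℕ M
          ≡⟨ cong₂ _-_ (cong (fromℕ P *_) (/-*-cancel (+ c) M)) (trans (cong (_* fromℕ M) (2^-k*2^k k)) (*-identityˡ (fromℕ M))) ⟩
        fromℕ P * fromℕ c - fromℕ M
          ≡⟨ cong (_- fromℕ M) (ι-* (+ P) (+ c)) ⟨
        ι (+ P ℤ.* + c) - fromℕ M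
          ≡⟨ ι-sub (+ P ℤ.* + c) (+ M) ⟨
        ι Δ ∎
      lhs : ∣ Pr S i σ - 2^- k ∣ * (fromℕ M * fromℕ P * fromℕ β) ≡ fromℕ (ℤ.∣ Δ ∣ ℕ.* β)
      lhs = begin
        ∣ Pr S i σ - 2^- k ∣ * (fromℕ M * fromℕ P * fromℕ β)
          ≡⟨ *-assoc ∣ Pr S i σ - 2^- k ∣ (fromℕ M * fromℕ P) (fromℕ β) ⟨
        ∣ Pr S i σ - 2^- k ∣ * (fromℕ M * fromℕ P) * fromℕ β
          ≡⟨ cong (λ z → ∣ Pr S i σ - 2^- k ∣ * z * fromℕ β)
               (trans (sym MP≡) (trans (sym (ι-∣∣ (+ (M ℕ.* P)))) (cong ∣_∣ MP≡))) ⟩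
        ∣ Pr S i σ - 2^- k ∣ * ∣ fromℕ M * fromℕ P ∣ * fromℕ β
          ≡⟨ cong (_* fromℕ β) (∣p*q∣≡∣p∣*∣q∣ (Pr S i σ - 2^- k) (fromℕ M * fromℕ P)) ⟨
        ∣ (Pr S i σ - 2^- k) * (fromℕ M * fromℕ P) ∣ * fromℕ β
          ≡⟨ cong (_* fromℕ β) (trans (cong ∣_∣ scaled) (ι-∣∣ Δ)) ⟩
        fromℕ ℤ.∣ Δ ∣ * fromℕ β
          ≡⟨ fromℕ-* ℤ.∣ Δ ∣ β ⟨
        fromℕ (ℤ.∣ Δ ∣ ℕ.* β) ∎
      rhs : ε * (fromℕ M * fromℕ P * fromℕ β) ≡ fromℕ (P ℕ.* α ℕ.* M)
      rhs = begin
        ε * (fromℕ M * fromℕ P * fromℕ β)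
          ≡⟨ solve 4 (λ e m p b → e :* (m :* p :* b) := p :* (e :* b) :* m) refl ε (fromℕ M) (fromℕ P) (fromℕ β) ⟩
        fromℕ P * (ε * fromℕ β) * fromℕ M
          ≡⟨ cong (λ z → fromℕ P * z * fromℕ M) εβ≡α ⟩
        fromℕ P * fromℕ α * fromℕ M
          ≡⟨ trans (fromℕ-* (P ℕ.* α) M) (cong (_* fromℕ M) (fromℕ-* P α)) ⟨
        fromℕ (P ℕ.* α ℕ.* M) ∎

    descale : ∀ K .{{_ : ℕ.NonZero K}} ℓ M P L → ℓ ℕ.* (β ℕ.* β) ℕ.≤ K ℕ.* (M ℕ.* (P ℕ.* (α ℕ.* α) ℕ.* L)) →
              (+ 1 / K) * fromℕ ℓ ≤ fromℕ M * (fromℕ P * (ε * ε) * fromℕ L)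
    descale K ℓ M P L le = *-cancelʳ-≤-pos (fromℕ K * fromℕ β²) {{scale-pos}} (subst₂ _≤_ (sym lhs) (sym rhs) (fromℕ-mono-≤ le))
      where
      open ≡-Reasoning
      β² = β ℕ.* β
      scale-pos : Positive (fromℕ K * fromℕ β²)
      scale-pos = subst Positive (fromℕ-* K β²) (fromℕ-pos (K ℕ.* β²) {{ℕP.m*n≢0 K β²}})
      lhs : (+ 1 / K) * fromℕ ℓ * (fromℕ K * fromℕ β²) ≡ fromℕ (ℓ ℕ.* β²)
      lhs = begin
        (+ 1 / K) * fromℕ ℓ * (fromℕ K * fromℕ β²)
          ≡⟨ solve 4 (λ x l k b → x :* l :* (k :* b) := x :* k :* (l :* b)) refl (+ 1 / K) (fromℕ ℓ) (fromℕ K) (fromℕ β²) ⟩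
        (+ 1 / K) * fromℕ K * (fromℕ ℓ * fromℕ β²)
          ≡⟨ cong₂ _*_ (/-*-cancel (+ 1) K) (sym (fromℕ-* ℓ β²)) ⟩
        1ℚ * fromℕ (ℓ ℕ.* β²)
          ≡⟨ *-identityˡ (fromℕ (ℓ ℕ.* β²)) ⟩
        fromℕ (ℓ ℕ.* β²) ∎
      rhs : fromℕ M * (fromℕ P * (ε * ε) * fromℕ L) * (fromℕ K * fromℕ β²)
            ≡ fromℕ (K ℕ.* (M ℕ.* (P ℕ.* (α ℕ.* α) ℕ.* L)))
      rhs = begin
        fromℕ M * (fromℕ P * (ε * ε) * fromℕ L) * (fromℕ K * fromℕ β²)
          ≡⟨ solve 6 (λ m p e l k b → m :* (p :* e :* l) :* (k :* b) := k :* (m :* (p :* (e :* b) :* l))) refl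
               (fromℕ M) (fromℕ P) (ε * ε) (fromℕ L) (fromℕ K) (fromℕ β²) ⟩
        fromℕ K * (fromℕ M * (fromℕ P * (ε * ε * fromℕ β²) * fromℕ L))
          ≡⟨ cong (λ z → fromℕ K * (fromℕ M * (fromℕ P * z * fromℕ L))) ε²β² ⟩
        fromℕ K * (fromℕ M * (fromℕ P * fromℕ (α ℕ.* α) * fromℕ L))
          ≡⟨ cong (λ z → fromℕ K * (fromℕ M * (z * fromℕ L))) (fromℕ-* P (α ℕ.* α)) ⟨
        fromℕ K * (fromℕ M * (fromℕ (P ℕ.* (α ℕ.* α)) * fromℕ L))
          ≡⟨ cong (λ z → fromℕ K * (fromℕ M * z)) (fromℕ-* (P ℕ.* (α ℕ.* α)) L) ⟨
        fromℕ K * (fromℕ M * fromℕ (P ℕ.* (α ℕ.* α) ℕ.* L))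
          ≡⟨ cong (fromℕ K *_) (fromℕ-* M (P ℕ.* (α ℕ.* α) ℕ.* L)) ⟨
        fromℕ K * fromℕ (M ℕ.* (P ℕ.* (α ℕ.* α) ℕ.* L))
          ≡⟨ fromℕ-* K (M ℕ.* (P ℕ.* (α ℕ.* α) ℕ.* L)) ⟨
        fromℕ (K ℕ.* (M ℕ.* (P ℕ.* (α ℕ.* α) ℕ.* L))) ∎

-- The two forms of the bound over the rationals

open import Defs
open import Data.Bool using (Bool)
open import Data.List using (List; length)
open import Data.List.Relation.Unary.Unique.Propositional using (Unique)
open import Data.Nat using (ℕ; suc; NonZero; ⌊_/2⌋)
import Data.Nat as ℕ
open import Data.Nat.Logarithm using (⌈log₂_⌉)
open import Data.Product using (Σ-syntax; _×_)
open import Data.Rational using (ℚ; _*_; _≤_; _<_; 0ℚ; 1ℚ; Positive)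
open import Data.Vec using (Vec)

open import Data.Integer using (+_; ∣_∣)
open import Data.Nat.Logarithm using (⌈log₂⌉-mono-≤)
import Data.Nat.Properties as ℕP
open import Data.Product using (_,_)
open import Data.Rational using (_/_; ↥_; ↧ₙ_)
open import Data.Rational.Properties using (positive⁻¹; normalize-pos)
open Counting using (constant; constant≢0; size-bound)
open Fractions

-- This lets the suppressed factors be taken to the first power: log(1/ε) already dominates, and the
-- other two factors are at least 1.
log≤polylog : ∀ n k .{{_ : NonZero k}} ε .{{_ : Positive ε}} → 2 ℕ.* k ℕ.< n →
  log[1/2^ k +1* ε ] ℕ.≤ (k ℕ.* ⌈log₂ ⌈log₂ n ⌉ ⌉ ℕ.* log[1/ ε ]) ℕ.^ 1
log≤polylog n k ε 2k<n = begin
  log[1/2^ k +1* ε ]                               ≤⟨ log-mono ε k ⟩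
  log[1/ ε ]                                       ≤⟨ ℕP.m≤n*m log[1/ ε ] (k ℕ.* loglog) ⟩
  k ℕ.* loglog ℕ.* log[1/ ε ]                      ≡⟨ ℕP.*-identityʳ (k ℕ.* loglog ℕ.* log[1/ ε ]) ⟨
  (k ℕ.* loglog ℕ.* log[1/ ε ]) ℕ.^ 1              ∎
  where
  open ℕP.≤-Reasoning
  loglog = ⌈log₂ ⌈log₂ n ⌉ ⌉
  -- At n = 2 the iterated logarithm would be 0; 1 ≤ k and 2k < n exclude this.
  3≤n : 3 ℕ.≤ n
  3≤n = ℕP.≤-trans (ℕ.s≤s (ℕP.*-monoʳ-≤ 2 (ℕ.>-nonZero⁻¹ k))) 2k<n
  instance
    loglog≢0 : NonZero loglog
    loglog≢0 = ℕ.>-nonZero (⌈log₂⌉-mono-≤ (⌈log₂⌉-mono-≤ 3≤n))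
    k*loglog≢0 : NonZero (k ℕ.* loglog)
    k*loglog≢0 = ℕP.m*n≢0 k loglog

theorem9 : (p : Polynomial) →
    Σ[ c ∈ ℚ ] Σ[ e ∈ ℕ ] (0ℚ < c ×
    ((n k : ℕ) .{{_ : NonZero n}} .{{_ : NonZero k}} (ε : ℚ) .{{_ : Positive ε}} →
    1ℚ ≤ fromℕ (eval p n) * ε →
    ε < 2^- suc k →
    2 ℕ.* k ℕ.< n →
    1ℚ ≤ (ε * ε) * fromℕ (n ℕ.^ ⌊ k /2⌋) →
    (S : List (Vec Bool n)) .{{_ : NonZero (length S)}} →
    Unique S →
    AlmostIndependent k ε S →
    (c * fromℕ ⌈log₂ n ⌉
    ≤ fromℕ (length S) * (fromℕ (2 ℕ.^ k) * (ε * ε) * fromℕ log[1/2^ k +1* ε ]))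
    ×
    (c * fromℕ ⌈log₂ n ⌉
    ≤ fromℕ (length S) * (fromℕ (2 ℕ.^ k) * (ε * ε)
    * fromℕ ((k ℕ.* ⌈log₂ ⌈log₂ n ⌉ ⌉ ℕ.* log[1/ ε ]) ℕ.^ e)))))
theorem9 p = + 1 / K , 1 , positive⁻¹ (+ 1 / K) {{normalize-pos 1 K}} ,
  λ n k ε 1≤pε ε<2^- 2k<n 1≤ε²n^ S _ almost →
    let
      α = ∣ ↥ ε ∣
      M = length S
      P = 2 ℕ.^ k
      bound = size-bound p α (↧ₙ ε) log[1/2^ k +1* ε ] S {{α≢0 = num≢0 ε}}
        (log-pos ε k ε<2^-) (almost⇒almostℕ ε k S almost) (denominator≤ ε (eval p n) 1≤pε)
        (<denominator ε k ε<2^-) 2k<n (denominator²≤ ε (n ℕ.^ ⌊ k /2⌋) 1≤ε²n^) (denominator≤2^log ε k)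
    in
    descale ε K ⌈log₂ n ⌉ M P log[1/2^ k +1* ε ] bound ,
    descale ε K ⌈log₂ n ⌉ M P ((k ℕ.* ⌈log₂ ⌈log₂ n ⌉ ⌉ ℕ.* log[1/ ε ]) ℕ.^ 1)
      (ℕP.≤-trans bound
        (ℕP.*-monoʳ-≤ K (ℕP.*-monoʳ-≤ M (ℕP.*-monoʳ-≤ (P ℕ.* (α ℕ.* α)) (log≤polylog n k ε 2k<n)))))
  where
  K = constant p
  instance
    K≢0 : NonZero K
    K≢0 = constant≢0 p
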